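{- Let $s \geq 3$ be an integer and let $G$ be a finite group with a $(2,s,3)$-presentation, that is, $G$ is generated by two elements $a$ and $b$ such that $a$ has order $2$, $b$ has order $s$, and the product $ab$ has order $3$. Let $X = \mathrm{Cay}(G,\{a,b,b^{ -1}\})$ be the corresponding (cubic) Cayley graph. Then: (1) if $|G| \equiv 2 \pmod 4$ (and thus also $s \equiv 2 \pmod 4$), then $X$ has a Hamilton cycle; (2) if $|G| \equiv 0 \pmod 4$, then $X$ has a cycle of length $|G|-2$, and thus necessarily a Hamilton path.
   Context: The presentation is written $G=\langle a,b \mid a^2=1,\ b^s=1,\ (ab)^3=1,\ \text{etc.}\rangle$, where "etc." means that additional relations may hold in $G$; the orders of $a$, $b$, $ab$ are exactly $2$, $s$, $3$ respectively. The Cayley graph $\mathrm{Cay}(G,\{a,b,b^{ -1}\})$ is the simple undirected graph with vertex set $G$ in which $g$ is adjacent to $ga$, $gb$ and $gb^{ -1}$ for every $g\in G$. A Hamilton cycle (respectively Hamilton path) is a simple cycle (respectively simple path) passing through all vertices of the graph. A cycle of length $\ell$ is a simple cycle on $\ell$ vertices. -}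

module Defs where

open import Algebra.Bundles using (Group)
import Algebra.Definitions.RawMonoid as RawMonoidDefs
import Algebra.Properties.Group as GroupProperties
open import Data.Fin.Base using (Fin)
open import Data.List.Base using (List; _∷_; _∷ʳ_; length)
import Data.List.Membership.Setoid as Membership
open import Data.List.Relation.Unary.Linked using (Linked)
import Data.List.Relation.Unary.Unique.Setoid as UniqueSetoid
open import Data.Nat.Base using (ℕ; _≤_; _<_; z≤n; s≤s)
open import Data.Nat.Properties using (<-irrefl; <-≤-trans; ≤-trans; n≤1+n)
open import Data.Product.Base using (∃; ∃₂; _×_; _,_)
open import Data.Sum.Base using (_⊎_; inj₁; inj₂)
open import Function.Bundles using (Inverse)
open import Level using (Level; _⊔_; suc)
open import Relation.Binary.Bundles using (Setoid)
open import Relation.Binary.Core using (Rel)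
open import Relation.Binary.Definitions using (Symmetric; Irreflexive; _Respects₂_)
open import Relation.Binary.PropositionalEquality.Core using (_≡_)
import Relation.Binary.PropositionalEquality.Properties as ≡
open import Relation.Nullary.Negation.Core using (¬_)
open import Relation.Unary using (Pred; _∈_)
import Relation.Binary.Reasoning.Setoid as SetoidReasoning

private
  variable
    c ℓ r : Level

------------------------------------------------------------------------
-- Simple graphs

record SimpleGraph (c ℓ r : Level) : Set (suc (c ⊔ ℓ ⊔ r)) where
  field
    vertices : Setoid c ℓ

  open Setoid vertices public using (_≈_) renaming (Carrier to Vertex)

  field
    _~_      : Rel Vertex r
    ~-resp-≈ : _~_ Respects₂ _≈_
    ~-sym    : Symmetric _~_
    ~-irrefl : Irreflexive _≈_ _~_

module _ (X : SimpleGraph c ℓ r) where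
  open SimpleGraph X
  open Membership vertices using () renaming (_∈_ to _∈ᴸ_)
  open UniqueSetoid vertices using (Unique)

  IsPath : List Vertex → Set (c ⊔ ℓ ⊔ r)
  IsPath vs = Linked _~_ vs × Unique vs

  -- The cycle v, v₁, …, vₖ, v is presented by its list v ∷ v₁ ∷ … ∷ vₖ of
  -- distinct vertices; appending v again accounts for the closing edge.
  -- The bound excludes a single vertex and an edge traversed back and forth.
  IsCycle : Vertex → List Vertex → Set (c ⊔ ℓ ⊔ r)
  IsCycle v vs =
    3 ≤ length (v ∷ vs) × Linked _~_ (v ∷ (vs ∷ʳ v)) × Unique (v ∷ vs)

  HasCycleOfLength : ℕ → Set (c ⊔ ℓ ⊔ r)
  HasCycleOfLength k = ∃₂ λ v vs → IsCycle v vs × length (v ∷ vs) ≡ k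

  HasHamiltonPath : Set (c ⊔ ℓ ⊔ r)
  HasHamiltonPath = ∃ λ vs → IsPath vs × (∀ u → u ∈ᴸ vs)

  HasHamiltonCycle : Set (c ⊔ ℓ ⊔ r)
  HasHamiltonCycle = ∃₂ λ v vs → IsCycle v vs × (∀ u → u ∈ᴸ (v ∷ vs))

------------------------------------------------------------------------
-- Groups

module _ (G : Group c ℓ) where
  open Group G
  -- The library's iterated operation, written multiplicatively: g ^ n is
  -- the n-fold product of g.
  open RawMonoidDefs rawMonoid using () renaming (_×_ to _×ᴹ_)

  _^_ : Carrier → ℕ → Carrier
  g ^ n = n ×ᴹ g

  HasCardinality : ℕ → Set (c ⊔ ℓ)
  HasCardinality n = Inverse setoid (≡.setoid (Fin n))

  record HasOrder (g : Carrier) (k : ℕ) : Set ℓ where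
    field
      positive : 0 < k
      power    : (g ^ k) ≈ ε
      minimal  : ∀ m → 0 < m → (g ^ m) ≈ ε → k ≤ m

  -- The subgroup generated by S. The constructor resp is needed because
  -- equality of group elements is the setoid equality.
  data ⟨_⟩ (S : Pred Carrier ℓ) : Pred Carrier (c ⊔ ℓ) where
    gen  : ∀ {g} → g ∈ S → g ∈ ⟨ S ⟩
    unit : ε ∈ ⟨ S ⟩
    mul  : ∀ {g h} → g ∈ ⟨ S ⟩ → h ∈ ⟨ S ⟩ → (g ∙ h) ∈ ⟨ S ⟩
    inv  : ∀ {g} → g ∈ ⟨ S ⟩ → (g ⁻¹) ∈ ⟨ S ⟩
    resp : ∀ {g h} → g ≈ h → g ∈ ⟨ S ⟩ → h ∈ ⟨ S ⟩

  record Has[2,_,3]Presentation (s : ℕ) (a b : Carrier) : Set (c ⊔ ℓ) where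
    field
      generate : ∀ g → g ∈ ⟨ (λ x → x ≈ a ⊎ x ≈ b) ⟩
      order-a  : HasOrder a 2
      order-b  : HasOrder b s
      order-ab : HasOrder (a ∙ b) 3

  CayAdj : Carrier → Carrier → Rel Carrier ℓ
  CayAdj a b g h = h ≈ g ∙ a ⊎ h ≈ g ∙ b ⊎ h ≈ g ∙ b ⁻¹

  private
    open GroupProperties G using (∙-cancelˡ; ⁻¹-injective; ε⁻¹≈ε)

    order≥2⇒≉ε : ∀ {g k} → 2 ≤ k → HasOrder g k → ¬ (g ≈ ε)
    order≥2⇒≉ε {g} 2≤k o g≈ε = <-irrefl _≡_.refl
      (<-≤-trans 2≤k (minimal 1 (s≤s z≤n) (trans (identityʳ g) g≈ε)))
      where open HasOrder o

    move : ∀ {g h x y} → x ∙ y ≈ ε → h ≈ g ∙ x → g ≈ h ∙ y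
    move {g} {h} {x} {y} xy≈ε h≈gx = begin
      g            ≈⟨ identityʳ g ⟨
      g ∙ ε        ≈⟨ ∙-congˡ xy≈ε ⟨
      g ∙ (x ∙ y)  ≈⟨ assoc g x y ⟨
      (g ∙ x) ∙ y  ≈⟨ ∙-congʳ h≈gx ⟨
      h ∙ y        ∎
      where open SetoidReasoning setoid

    fixed⇒≈ε : ∀ {g h x} → g ≈ h → h ≈ g ∙ x → x ≈ ε
    fixed⇒≈ε {g} {h} {x} g≈h h≈gx =
      ∙-cancelˡ g x ε (trans (sym h≈gx) (trans (sym g≈h) (sym (identityʳ g))))

  -- Cay(G, {a, b, b⁻¹})
  Cay : ∀ {s a b} → 3 ≤ s → Has[2, s ,3]Presentation a b → SimpleGraph c ℓ ℓ
  Cay {s} {a} {b} s≥3 P = record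
    { vertices = setoid
    ; _~_      = CayAdj a b
    ; ~-resp-≈ = respʳ , respˡ
    ; ~-sym    = symm
    ; ~-irrefl = irr
    }
    where
    open Has[2,_,3]Presentation P

    a∙a≈ε : a ∙ a ≈ ε
    a∙a≈ε = trans (∙-congˡ (sym (identityʳ a))) (HasOrder.power order-a)

    a≉ε : ¬ (a ≈ ε)
    a≉ε = order≥2⇒≉ε (s≤s (s≤s z≤n)) order-a

    b≉ε : ¬ (b ≈ ε)
    b≉ε = order≥2⇒≉ε (≤-trans (n≤1+n 2) s≥3) order-b

    respʳ : ∀ {g h h′} → h ≈ h′ → CayAdj a b g h → CayAdj a b g h′
    respʳ e (inj₁ p)        = inj₁ (trans (sym e) p)
    respʳ e (inj₂ (inj₁ p)) = inj₂ (inj₁ (trans (sym e) p))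
    respʳ e (inj₂ (inj₂ p)) = inj₂ (inj₂ (trans (sym e) p))

    respˡ : ∀ {h g g′} → g ≈ g′ → CayAdj a b g h → CayAdj a b g′ h
    respˡ e (inj₁ p)        = inj₁ (trans p (∙-congʳ e))
    respˡ e (inj₂ (inj₁ p)) = inj₂ (inj₁ (trans p (∙-congʳ e)))
    respˡ e (inj₂ (inj₂ p)) = inj₂ (inj₂ (trans p (∙-congʳ e)))

    symm : Symmetric (CayAdj a b)
    symm (inj₁ p)        = inj₁ (move a∙a≈ε p)
    symm (inj₂ (inj₁ p)) = inj₂ (inj₂ (move (inverseʳ b) p))
    symm (inj₂ (inj₂ p)) = inj₂ (inj₁ (move (inverseˡ b) p))

    irr : Irreflexive _≈_ (CayAdj a b)
    irr e (inj₁ p)        = a≉ε (fixed⇒≈ε e p)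
    irr e (inj₂ (inj₁ p)) = b≉ε (fixed⇒≈ε e p)
    irr e (inj₂ (inj₂ p)) = b≉ε (⁻¹-injective (trans (fixed⇒≈ε e p) (sym ε⁻¹≈ε)))

{-# OPTIONS --safe #-}
-- The Cayley graph lies on a closed surface with hexagonal faces (the cosets of ⟨ba⟩) and s-gonal
-- faces (the cosets of ⟨b⟩). Contracting the s-gons to points turns the hexagons into triangles of a
-- regular triangulation. If a set F of triangles is a forest, that is, if its triangles successively
-- merge three classes of s-gons into one, then replacing b by a along the hexagons of F gives a
-- permutation whose cycles are exactly the classes left by F.
--
-- A maximum forest leaves at most two classes: call two edges of the triangulation dependent if no
-- maximum forest separates the ends of both independently. An exchange argument makes dependence
-- transitive (every edge is separated by some maximum forest, by arc-transitivity, as soon as one is),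
-- two edges of a triangle are dependent by maximality, and connectedness makes all edges dependent.
-- The number of classes has the parity of |G|/2. If it is 1, the permutation is a Hamilton cycle.
--
-- If it is 2, a further exchange produces a maximum forest containing a triangle adjacent, across the
-- edge from g to ga, to a triangle that meets both classes. Merging the two cycles along the latter
-- leaves out exactly g and ga.
module Submission where

open import Defs
open import Algebra.Bundles using (Group)
open import Data.Nat.Base using (ℕ; _≤_; _∸_; _%_)
open import Data.Product.Base using (_×_)
open import Relation.Binary.PropositionalEquality.Core using (_≡_)

import Algebra.Properties.Group as GroupProperties
open import Data.Empty using (⊥-elim)
open import Data.Fin.Base using (Fin; zero; suc; toℕ; fromℕ<; punchIn; combine; remQuot)
open import Data.Fin.Properties
  using (_≟_; any?; injective⇒≤; pigeonhole; punchInᵢ≢i; punchIn-injective; punchIn-punchOut;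
         toℕ<n; toℕ-fromℕ<; toℕ-injective; combine-injective; combine-remQuot; ¬∀⟶∃¬)
open import Data.List.Base using (List; []; _∷_; allFin; _++_; length; map; applyUpTo; _∷ʳ_)
open import Data.List.Membership.Propositional using (_∈_; _∉_; find)
open import Data.List.Membership.Propositional.Properties
  using (∈-∃++; ∈-++⁺ˡ; ∈-++⁺ʳ; ∈-++⁻; ∈-map⁺; ∈-allFin)
import Data.List.Membership.Setoid as Membership
open import Data.List.Membership.Setoid.Properties using (∈-resp-≈) renaming (∈-applyUpTo⁺ to ∈ˢ-applyUpTo⁺)
open import Data.List.Properties using (length-++; length-map; length-applyUpTo; map-∘; map-id; map-cong)
open import Data.List.Relation.Unary.All as All using (All; []; _∷_)
open import Data.List.Relation.Unary.All.Properties using (¬All⇒Any¬)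
open import Data.List.Relation.Unary.Any using (here; there)
open import Data.List.Relation.Unary.Linked using (Linked; []; [-]; _∷_)
open import Data.List.Relation.Unary.Linked.Properties using (applyUpTo⁺₁)
open import Data.List.Relation.Unary.Unique.Setoid using (Unique)
import Data.List.Relation.Unary.Unique.Setoid.Properties as Unique
open import Data.Nat.Base using (zero; suc; _+_; _*_; _<_; z≤n; s≤s; s≤s⁻¹; parity; NonZero)
open import Data.Nat.DivMod using (m%n<n; m≡m%n+[m/n]*n; _/_; %-distribˡ-*)
open import Data.Nat.GeneralisedArithmetic using (fold; fold-+)
import Data.Nat.Properties as ℕ
open import Data.Parity.Base using (0ℙ; 1ℙ; _⁻¹)
import Data.Parity.Properties as ℙ
open import Data.Product.Base using (Σ; ∃; ∃₂; _,_; proj₁; proj₂)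
open import Data.Sum.Base using (_⊎_; inj₁; inj₂; [_,_]′)
open import Data.Vec.Functional using () renaming (_∷_ to _∷ᵛ_)
open import Function.Base using (_∘_; id)
open import Function.Bundles using (Inverse)
open import Relation.Binary.Definitions using (tri<; tri≈; tri>)
open import Relation.Binary.PropositionalEquality.Core using (refl; sym; trans; cong; cong₂; subst; subst₂; _≢_)
open import Relation.Binary.Structures using (IsEquivalence; IsDecEquivalence)
open import Relation.Nullary using (¬_; Dec; yes; no; contradiction)
open import Relation.Nullary.Decidable using (_⊎-dec_; _×-dec_; ¬?; map′; decidable-stable)

-- Counting the classes of a decidable equivalence

-- A triangle adds two edges at once to the graph on the s-gons, so choosing a forest of triangles
-- is a matroid parity problem, and exchanging members between two maximum forests is not always
-- possible. What rescues the exchange is a pair p, q kept separated: a triangle that merges classes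
-- even after p and q are identified, but not three of them before, merges exactly two, and such a
-- triangle can replace another one without loss and without joining p to q. Every such claim is a
-- comparison of class counts `c` along two orders of adding the same edges, where an edge lowers
-- `c` by at most 1 and a triangle by at most 2.
--
-- The parity comes from the fact that a toggle precomposes with a 3-cycle, an even permutation,
-- while toggling every triangle turns b into a, whose orbits number |G|/2.
--
-- When two classes remain, an odd number of merges is missing, which triangles of a forest cannot
-- supply. Two adjacent triangles sharing an edge can: together they have four corners, hence merge
-- three times.

record DecEquivalence (V : Set) : Set₁ where
  no-eta-equality
  field
    _≈_              : V → V → Set
    isDecEquivalence : IsDecEquivalence _≈_

  module ≈ = IsDecEquivalence isDecEquivalence

  infix 4 _≈?_
  _≈?_ : ∀ x y → Dec (x ≈ y)
  _≈?_ = ≈._≟_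

record Transversal {V : Set} (R : DecEquivalence V) (k : ℕ) : Set where
  open DecEquivalence R
  field
    rep      : Fin k → V
    cover    : ∀ v → ∃ λ i → v ≈ rep i
    distinct : ∀ {i j} → rep i ≈ rep j → i ≡ j

module _ {V : Set} where
  open DecEquivalence using (_≈?_; module ≈) renaming (_≈_ to Rel)

  transversal-antimono : ∀ {R S : DecEquivalence V} {k l} → (∀ {x y} → Rel R x y → Rel S x y) →
                         Transversal R k → Transversal S l → l ≤ k
  transversal-antimono {R} {S} R⊆S tR tS = injective⇒≤ {f = λ j → proj₁ (R.cover (S.rep j))} λ {i} {j} eq →
    S.distinct (R⊆S (≈.trans R (proj₂ (R.cover (S.rep i)))
      (≈.sym R (subst (λ k → Rel R (S.rep j) (R.rep k)) (sym eq) (proj₂ (R.cover (S.rep j)))))))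
    where
    module R = Transversal tR
    module S = Transversal tS

  image-transversal : (R : DecEquivalence V) → ∀ m (f : Fin m → V) →
    ∃ λ k → Σ (Fin k → V) λ ρ →
      (∀ i → ∃ λ j → Rel R (f i) (ρ j)) × (∀ {i j} → Rel R (ρ i) (ρ j) → i ≡ j)
  image-transversal R zero    f = 0 , (λ ()) , (λ ()) , λ { {()} }
  image-transversal R (suc m) f with image-transversal R m (f ∘ suc)
  ... | k , ρ , cov , dis with any? (λ j → _≈?_ R (f zero) (ρ j))
  ... | yes p = k , ρ , (λ { zero → p ; (suc i) → cov i }) , dis
  ... | no ¬p = suc k , f zero ∷ᵛ ρ
              , (λ { zero → zero , ≈.refl R ; (suc i) → suc (proj₁ (cov i)) , proj₂ (cov i) })
              , λ { {zero} {zero} _ → refl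
                  ; {zero} {suc j} p → contradiction (j , p) ¬p
                  ; {suc i} {zero} p → contradiction (i , ≈.sym R p) ¬p
                  ; {suc i} {suc j} p → cong suc (dis p) }

  module _ (R : DecEquivalence V) (p q : V) where

    -- A chain from x to y needs the new pair at most once, in one direction or the other, so these
    -- three cases are already transitive.
    Join : V → V → Set
    Join x y = Rel R x y ⊎ (Rel R x p × Rel R q y) ⊎ (Rel R x q × Rel R p y)

    private
      tr : ∀ {x y z} → Join x y → Join y z → Join x z
      tr (inj₁ e) (inj₁ f) = inj₁ (≈.trans R e f)
      tr (inj₁ e) (inj₂ (inj₁ (f , g))) = inj₂ (inj₁ (≈.trans R e f , g))
      tr (inj₁ e) (inj₂ (inj₂ (f , g))) = inj₂ (inj₂ (≈.trans R e f , g))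
      tr (inj₂ (inj₁ (e , f))) (inj₁ g) = inj₂ (inj₁ (e , ≈.trans R f g))
      tr (inj₂ (inj₂ (e , f))) (inj₁ g) = inj₂ (inj₂ (e , ≈.trans R f g))
      tr (inj₂ (inj₁ (e , f))) (inj₂ (inj₁ (g , h))) = inj₂ (inj₁ (e , h))
      tr (inj₂ (inj₁ (e , f))) (inj₂ (inj₂ (g , h))) = inj₁ (≈.trans R e h)
      tr (inj₂ (inj₂ (e , f))) (inj₂ (inj₁ (g , h))) = inj₁ (≈.trans R e h)
      tr (inj₂ (inj₂ (e , f))) (inj₂ (inj₂ (g , h))) = inj₂ (inj₂ (e , h))

    abstract
      join-isDecEquivalence : IsDecEquivalence Join
      join-isDecEquivalence = record
        { isEquivalence = record
          { refl  = inj₁ (≈.refl R)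
          ; sym   = λ { (inj₁ e) → inj₁ (≈.sym R e)
                      ; (inj₂ (inj₁ (e , f))) → inj₂ (inj₂ (≈.sym R f , ≈.sym R e))
                      ; (inj₂ (inj₂ (e , f))) → inj₂ (inj₁ (≈.sym R f , ≈.sym R e)) }
          ; trans = tr }
        ; _≟_ = λ x y → (_≈?_ R x y) ⊎-dec ((_≈?_ R x p ×-dec _≈?_ R q y) ⊎-dec (_≈?_ R x q ×-dec _≈?_ R p y)) }

    join : DecEquivalence V
    join = record { _≈_ = Join ; isDecEquivalence = join-isDecEquivalence }

  join-least : ∀ (R : DecEquivalence V) {p q} {S : V → V → Set} → IsEquivalence S →
               (∀ {x y} → Rel R x y → S x y) → S p q → ∀ {x y} → Rel (join R p q) x y → S x y
  join-least R eq R⊆S pq (inj₁ e) = R⊆S e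
  join-least R eq R⊆S pq (inj₂ (inj₁ (e , f))) =
    IsEquivalence.trans eq (R⊆S e) (IsEquivalence.trans eq pq (R⊆S f))
  join-least R eq R⊆S pq (inj₂ (inj₂ (e , f))) =
    IsEquivalence.trans eq (R⊆S e) (IsEquivalence.trans eq (IsEquivalence.sym eq pq) (R⊆S f))

  join-transversal : ∀ (R : DecEquivalence V) {p q k} → ¬ Rel R p q → Transversal R k →
                     ∃ λ l → k ≡ suc l × Transversal (join R p q) l
  join-transversal R {p} {q} {zero}  p≉q t with () ← proj₁ (Transversal.cover t p)
  join-transversal R {p} {q} {suc l} p≉q t = l , refl , record
    -- The representative of the class of q is dropped; that of the class of p serves for both.
    { rep      = rep ∘ punchIn iq
    ; cover    = cov
    ; distinct = λ {i} {j} → dis {i} {j} }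
    where
    open Transversal t
    iq ip : Fin (suc l)
    iq = proj₁ (cover q)
    ip = proj₁ (cover p)
    q≈ : Rel R q (rep iq)
    q≈ = proj₂ (cover q)
    p≈ : Rel R p (rep ip)
    p≈ = proj₂ (cover p)
    iq≢ip : iq ≢ ip
    iq≢ip eq = p≉q (≈.trans R p≈ (≈.sym R (subst (λ i → Rel R q (rep i)) eq q≈)))
    lift : ∀ {v i} → iq ≢ i → Rel R v (rep i) → ∃ λ j → Rel R v (rep (punchIn iq j))
    lift {v} ne e = _ , subst (λ i → Rel R v (rep i)) (sym (punchIn-punchOut ne)) e
    cov : ∀ v → ∃ λ i → Rel (join R p q) v (rep (punchIn iq i))
    cov v with cover v
    ... | i , e with iq ≟ i
    ... | no ne    = let j , f = lift ne e in j , inj₁ f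
    ... | yes refl = let j , f = lift iq≢ip p≈ in j , inj₂ (inj₂ (≈.trans R e (≈.sym R q≈) , f))
    off : ∀ {i} → ¬ Rel R q (rep (punchIn iq i))
    off {i} e = punchInᵢ≢i iq i (distinct (≈.trans R (≈.sym R e) q≈))
    dis : ∀ {i j} → Rel (join R p q) (rep (punchIn iq i)) (rep (punchIn iq j)) → i ≡ j
    dis {i} {j} (inj₁ e) = punchIn-injective iq i j (distinct e)
    dis {i} {j} (inj₂ (inj₁ (e , f))) = contradiction f (off {j})
    dis {i} {j} (inj₂ (inj₂ (e , f))) = contradiction (≈.sym R e) (off {i})

module _ {n : ℕ} where
  open DecEquivalence using () renaming (_≈_ to Rel)

  transversal : (R : DecEquivalence (Fin n)) → ∃ (Transversal R)
  transversal R = let k , ρ , cov , dis = image-transversal R n id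
                  in k , record { rep = ρ ; cover = cov ; distinct = dis }

  abstract
    #_ : DecEquivalence (Fin n) → ℕ
    # R = proj₁ (transversal R)

    #-transversal : ∀ R → Transversal R (# R)
    #-transversal R = proj₂ (transversal R)

    #-antimono : ∀ (R S : DecEquivalence (Fin n)) → (∀ {x y} → Rel R x y → Rel S x y) → # S ≤ # R
    #-antimono R S R⊆S = transversal-antimono R⊆S (proj₂ (transversal R)) (proj₂ (transversal S))

    #-unique : ∀ (R : DecEquivalence (Fin n)) {k} → Transversal R k → k ≡ # R
    #-unique R t = ℕ.≤-antisym (transversal-antimono id (proj₂ (transversal R)) t)
                               (transversal-antimono id t (proj₂ (transversal R)))

    #-total : ∀ (R : DecEquivalence (Fin n)) → (∀ x y → Rel R x y) → # R ≤ 1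
    #-total R total = injective⇒≤ {f = λ _ → zero} λ _ → Transversal.distinct (#-transversal R) (total _ _)

    #-positive : ∀ (R : DecEquivalence (Fin n)) → Fin n → 1 ≤ # R
    #-positive R x = positive (proj₁ (Transversal.cover (#-transversal R) x))
      where
      positive : ∀ {k} → Fin k → 1 ≤ k
      positive zero    = s≤s z≤n
      positive (suc _) = s≤s z≤n

    #-join-∈ : ∀ (R : DecEquivalence (Fin n)) {p q} → Rel R p q → # join R p q ≡ # R
    #-join-∈ R p≈q = ℕ.≤-antisym (#-antimono R (join R _ _) inj₁)
      (#-antimono (join R _ _) R (join-least R (IsDecEquivalence.isEquivalence (DecEquivalence.isDecEquivalence R)) id p≈q))

    #-join-∉ : ∀ (R : DecEquivalence (Fin n)) {p q} → ¬ Rel R p q → # R ≡ suc (# join R p q)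
    #-join-∉ R p≉q with join-transversal R p≉q (proj₂ (transversal R))
    ... | l , eq , t = trans eq (cong suc (#-unique (join R _ _) t))

-- Triangle forests

module Span {n : ℕ} (E : DecEquivalence (Fin n)) where
  open DecEquivalence using (_≈?_; module ≈; isDecEquivalence) renaming (_≈_ to Rel)

  private
    V = Fin n

  Edges : Set
  Edges = List (V × V)

  span : Edges → DecEquivalence V
  span []            = E
  span ((p , q) ∷ X) = join (span X) p q

  infix 4 _⊢_≈_
  _⊢_≈_ : Edges → V → V → Set
  X ⊢ x ≈ y = Rel (span X) x y

  ⊢? : ∀ X x y → Dec (X ⊢ x ≈ y)
  ⊢? X = _≈?_ (span X)

  ⊢-refl : ∀ X {x} → X ⊢ x ≈ x
  ⊢-refl X = ≈.refl (span X)

  ⊢-sym : ∀ X {x y} → X ⊢ x ≈ y → X ⊢ y ≈ x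
  ⊢-sym X = ≈.sym (span X)

  ⊢-trans : ∀ X {x y z} → X ⊢ x ≈ y → X ⊢ y ≈ z → X ⊢ x ≈ z
  ⊢-trans X = ≈.trans (span X)

  ⊢-isEquivalence : ∀ X → IsEquivalence (X ⊢_≈_)
  ⊢-isEquivalence X = IsDecEquivalence.isEquivalence (isDecEquivalence (span X))

  ⊢-base : ∀ X {x y} → Rel E x y → X ⊢ x ≈ y
  ⊢-base []      e = e
  ⊢-base (_ ∷ X) e = inj₁ (⊢-base X e)

  ⊢-head : ∀ {p q} X → (p , q) ∷ X ⊢ p ≈ q
  ⊢-head X = inj₂ (inj₁ (⊢-refl X , ⊢-refl X))

  span-least : ∀ X {S : V → V → Set} → IsEquivalence S → (∀ {x y} → Rel E x y → S x y) →
               All (λ e → S (proj₁ e) (proj₂ e)) X → ∀ {x y} → X ⊢ x ≈ y → S x y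
  span-least []      eq E⊆S []       = E⊆S
  span-least (_ ∷ X) eq E⊆S (e ∷ es) = join-least (span X) eq (span-least X eq E⊆S es) e

  infix 4 _⊑_
  -- Inclusion of the generated equivalences, tested on the edges of X alone because `span` is
  -- least.
  record _⊑_ (X Y : Edges) : Set where
    constructor edges
    field edges-joined : All (λ e → Y ⊢ proj₁ e ≈ proj₂ e) X

    ⊑⇒⊆ : ∀ {x y} → X ⊢ x ≈ y → Y ⊢ x ≈ y
    ⊑⇒⊆ = span-least X (⊢-isEquivalence Y) (⊢-base Y) edges-joined

  open _⊑_

  ⊑-trans : ∀ {X Y Z} → X ⊑ Y → Y ⊑ Z → X ⊑ Z
  ⊑-trans X⊑Y Y⊑Z = edges (All.map (⊑⇒⊆ Y⊑Z) (edges-joined X⊑Y))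

  ⊑-∷ʳ : ∀ {X Y} e → X ⊑ Y → X ⊑ e ∷ Y
  ⊑-∷ʳ e X⊑Y = edges (All.map inj₁ (edges-joined X⊑Y))

  ⊑-[] : ∀ {Y} → [] ⊑ Y
  ⊑-[] = edges []

  ⊑-∷ˡ : ∀ {X Y p q} → Y ⊢ p ≈ q → X ⊑ Y → (p , q) ∷ X ⊑ Y
  ⊑-∷ˡ e X⊑Y = edges (e ∷ edges-joined X⊑Y)

  ⊑-refl : ∀ X → X ⊑ X
  ⊑-refl []      = ⊑-[]
  ⊑-refl (e ∷ X) = ⊑-∷ˡ (⊢-head X) (⊑-∷ʳ e (⊑-refl X))

  ∷-⊑-∷ : ∀ {X Y} e → X ⊑ Y → e ∷ X ⊑ e ∷ Y
  ∷-⊑-∷ {Y = Y} e X⊑Y = ⊑-∷ˡ (⊢-head Y) (⊑-∷ʳ e X⊑Y)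

  abstract
    c : Edges → ℕ
    c X = # span X

    c-≡ : ∀ X → c X ≡ # span X
    c-≡ X = refl

    c-antimono : ∀ {X Y} → X ⊑ Y → c Y ≤ c X
    c-antimono {X} {Y} X⊑Y = #-antimono (span X) (span Y) (⊑⇒⊆ X⊑Y)

    c-∈ : ∀ X {p q} → X ⊢ p ≈ q → c ((p , q) ∷ X) ≡ c X
    c-∈ X = #-join-∈ (span X)

    c-∉ : ∀ X {p q} → ¬ X ⊢ p ≈ q → c X ≡ suc (c ((p , q) ∷ X))
    c-∉ X = #-join-∉ (span X)

  c-∷ : ∀ X p q → c X ≤ suc (c ((p , q) ∷ X))
  c-∷ X p q with ⊢? X p q
  ... | yes e = ℕ.m≤n⇒m≤1+n (ℕ.≤-reflexive (sym (c-∈ X e)))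
  ... | no ¬e = ℕ.≤-reflexive (c-∉ X ¬e)

  module Triangles (β : V → V) where

    infixr 5 _▹_
    -- Two sides of a triangle suffice to merge its three corners.
    _▹_ : List V → Edges → Edges
    []      ▹ Y = Y
    (h ∷ F) ▹ Y = (h , β h) ∷ (β h , β (β h)) ∷ (F ▹ Y)

    Joined : Edges → V → Set
    Joined X h = X ⊢ h ≈ β h × X ⊢ β h ≈ β (β h)

    Joined? : ∀ X h → Dec (Joined X h)
    Joined? X h = ⊢? X _ _ ×-dec ⊢? X _ _

    -- Adding h lowers `c` by 2 if h is split, by 0 if it is joined, and by 1 otherwise; this
    -- trichotomy is the rank function behind all exchanges.
    Split : Edges → V → Set
    Split X h = ¬ X ⊢ h ≈ β h × ¬ X ⊢ β h ≈ β (β h) × ¬ X ⊢ h ≈ β (β h)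

    Split? : ∀ X h → Dec (Split X h)
    Split? X h = ¬? (⊢? X _ _) ×-dec (¬? (⊢? X _ _) ×-dec ¬? (⊢? X _ _))

    Joined-mono : ∀ {X Y h} → X ⊑ Y → Joined X h → Joined Y h
    Joined-mono X⊑Y (e , f) = ⊑⇒⊆ X⊑Y e , ⊑⇒⊆ X⊑Y f

    Split-antimono : ∀ {X Y h} → X ⊑ Y → Split Y h → Split X h
    Split-antimono X⊑Y (e , f , g) = e ∘ ⊑⇒⊆ X⊑Y , f ∘ ⊑⇒⊆ X⊑Y , g ∘ ⊑⇒⊆ X⊑Y

    ▹-⊒ : ∀ F Y → Y ⊑ F ▹ Y
    ▹-⊒ []      Y = ⊑-refl Y
    ▹-⊒ (h ∷ F) Y = ⊑-∷ʳ _ (⊑-∷ʳ _ (▹-⊒ F Y))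

    ▹-joined : ∀ {F h} Y → h ∈ F → Joined (F ▹ Y) h
    ▹-joined {h ∷ F} Y (here refl) = ⊢-head ((β h , β (β h)) ∷ (F ▹ Y)) , inj₁ (⊢-head (F ▹ Y))
    ▹-joined {h ∷ F} Y (there k∈F) = Joined-mono (⊑-∷ʳ _ (⊑-∷ʳ _ (⊑-refl (F ▹ Y)))) (▹-joined Y k∈F)

    ▹-all : ∀ {F Y} {S : V → V → Set} → (∀ {h} → h ∈ F → S h (β h) × S (β h) (β (β h))) →
            All (λ e → S (proj₁ e) (proj₂ e)) Y → All (λ e → S (proj₁ e) (proj₂ e)) (F ▹ Y)
    ▹-all {[]}    F⊆S Y⊆S = Y⊆S
    ▹-all {h ∷ F} F⊆S Y⊆S = proj₁ (F⊆S (here refl)) ∷ proj₂ (F⊆S (here refl)) ∷ ▹-all (F⊆S ∘ there) Y⊆S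

    ▹-⊑ : ∀ {F Y Z} → (∀ {h} → h ∈ F → Joined Z h) → Y ⊑ Z → F ▹ Y ⊑ Z
    ▹-⊑ {Z = Z} F⊆Z Y⊑Z = edges (▹-all {S = Z ⊢_≈_} F⊆Z (edges-joined Y⊑Z))

    ▹-mono : ∀ {F G Y Z} → (∀ {h} → h ∈ F → h ∈ G) → Y ⊑ Z → F ▹ Y ⊑ G ▹ Z
    ▹-mono {F} {G} {Y} {Z} F⊆G Y⊑Z = ▹-⊑ {F} (▹-joined Z ∘ F⊆G) (⊑-trans Y⊑Z (▹-⊒ G Z))

    ++-▹ : ∀ F G {Y} → (F ++ G) ▹ Y ≡ F ▹ (G ▹ Y)
    ++-▹ []      G = refl
    ++-▹ (h ∷ F) G = cong (λ X → (h , β h) ∷ (β h , β (β h)) ∷ X) (++-▹ F G)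

    push : ∀ F m Y → (m ∷ F) ▹ Y ⊑ F ▹ (m ∷ []) ▹ Y
    push F m Y = ▹-⊑ {m ∷ F} {Y}
      (λ { (here refl) → Joined-mono (▹-⊒ F _) (▹-joined {m ∷ []} Y (here refl))
         ; (there h∈F) → ▹-joined {F} _ h∈F })
      (⊑-trans (▹-⊒ (m ∷ []) Y) (▹-⊒ F _))

    ▹-∷-comm : ∀ F e Y → F ▹ (e ∷ Y) ⊑ e ∷ (F ▹ Y)
    ▹-∷-comm F e Y = ▹-⊑ {F} (λ h∈F → Joined-mono (⊑-∷ʳ e (⊑-refl (F ▹ Y))) (▹-joined Y h∈F))
                             (∷-⊑-∷ e (▹-⊒ F Y))

    ∷-▹-comm : ∀ F e Y → e ∷ (F ▹ Y) ⊑ F ▹ (e ∷ Y)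
    ∷-▹-comm F e Y = ⊑-∷ˡ (⊑⇒⊆ (▹-⊒ F (e ∷ Y)) (⊢-head Y)) (▹-mono {F} {F} id (⊑-∷ʳ e (⊑-refl Y)))

    c-▹₁ : ∀ X h → c X ≤ 2 + c ((h ∷ []) ▹ X)
    c-▹₁ X h = ℕ.≤-trans (c-∷ X (β h) (β (β h))) (s≤s (c-∷ ((β h , β (β h)) ∷ X) h (β h)))

    split⇒ : ∀ X {h} → Split X h → c X ≡ 2 + c ((h ∷ []) ▹ X)
    split⇒ X {h} (e , f , g) = trans (c-∉ X f) (cong suc (c-∉ ((β h , β (β h)) ∷ X) λ
      { (inj₁ p) → e p ; (inj₂ (inj₁ (p , _))) → e p ; (inj₂ (inj₂ (p , _))) → g p }))

    ¬split⇒ : ∀ X {h} → ¬ Split X h → c X ≤ 1 + c ((h ∷ []) ▹ X)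
    ¬split⇒ X {h} ¬s with ⊢? X (β h) (β (β h))
    ... | yes f = ℕ.≤-trans (ℕ.≤-reflexive (sym (c-∈ X f))) (c-∷ ((β h , β (β h)) ∷ X) h (β h))
    ... | no ¬f with ⊢? X h (β h)
    ... | yes e = ℕ.≤-reflexive (trans (c-∉ X ¬f) (cong suc (sym (c-∈ ((β h , β (β h)) ∷ X) (inj₁ e)))))
    ... | no ¬e with ⊢? X h (β (β h))
    ... | yes g = ℕ.≤-reflexive (trans (c-∉ X ¬f) (cong suc (sym (c-∈ ((β h , β (β h)) ∷ X) (inj₂ (inj₂ (g , ⊢-refl X)))))))
    ... | no ¬g = contradiction (¬e , ¬f , ¬g) ¬s

    ⇒split : ∀ X {h} → 2 + c ((h ∷ []) ▹ X) ≤ c X → Split X h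
    ⇒split X {h} le with Split? X h
    ... | yes s = s
    ... | no ¬s = contradiction (ℕ.≤-trans le (¬split⇒ X ¬s)) ℕ.1+n≰n

    ¬joined⇒ : ∀ X {h} → ¬ Joined X h → suc (c ((h ∷ []) ▹ X)) ≤ c X
    ¬joined⇒ X {h} ¬j with ⊢? X (β h) (β (β h))
    ... | no ¬f = ℕ.≤-trans (s≤s (c-antimono (⊑-∷ʳ _ (⊑-refl ((_ , _) ∷ X))))) (ℕ.≤-reflexive (sym (c-∉ X ¬f)))
    ... | yes f with ⊢? X h (β h)
    ... | yes e = contradiction (e , f) ¬j
    ... | no ¬e = ℕ.≤-reflexive (trans (sym (c-∉ ((β h , β (β h)) ∷ X) λ
      { (inj₁ p) → ¬e p ; (inj₂ (inj₁ (p , _))) → ¬e p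
      ; (inj₂ (inj₂ (p , _))) → ¬e (⊢-trans X p (⊢-sym X f)) })) (c-∈ X f))

    c-▹ : ∀ F Y → c Y ≤ length F * 2 + c (F ▹ Y)
    c-▹ []      Y = ℕ.≤-refl
    c-▹ (h ∷ F) Y = ℕ.≤-trans (c-▹ F Y) (ℕ.≤-trans (ℕ.+-monoʳ-≤ (length F * 2) (c-▹₁ (F ▹ Y) h))
      (ℕ.≤-reflexive (trans (ℕ.+-suc (length F * 2) _) (cong suc (ℕ.+-suc (length F * 2) _)))))

    -- As a triangle lowers c by at most 2, this says that each triangle of F merges three classes.
    Forest : Edges → List V → Set
    Forest Y F = length F * 2 + c (F ▹ Y) ≤ c Y

    forest-c : ∀ {Y F} → Forest Y F → length F * 2 + c (F ▹ Y) ≡ c Y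
    forest-c {Y} {F} fF = ℕ.≤-antisym fF (c-▹ F Y)

    forest-∷⁺ : ∀ {Y F h} → Forest Y F → Split (F ▹ Y) h → Forest Y (h ∷ F)
    forest-∷⁺ {Y} {F} fF s = ℕ.≤-trans (ℕ.≤-reflexive
      (trans (sym (trans (ℕ.+-suc (length F * 2) _) (cong suc (ℕ.+-suc (length F * 2) _))))
             (cong (length F * 2 +_) (sym (split⇒ (F ▹ Y) s))))) fF

    forest-∷⁻ : ∀ {Y F h} → Forest Y (h ∷ F) → Forest Y F × Split (F ▹ Y) h
    forest-∷⁻ {Y} {F} {h} fF = ℕ.≤-trans (ℕ.+-monoʳ-≤ (length F * 2) (c-▹₁ (F ▹ Y) h)) (ℕ.≤-trans (ℕ.≤-reflexive shift) fF)
      , ⇒split (F ▹ Y) (ℕ.+-cancelˡ-≤ (length F * 2) _ _ (ℕ.≤-trans (ℕ.≤-reflexive shift) (ℕ.≤-trans fF (c-▹ F Y))))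
      where
      shift : length F * 2 + (2 + c ((h ∷ F) ▹ Y)) ≡ 2 + (length F * 2 + c ((h ∷ F) ▹ Y))
      shift = trans (ℕ.+-suc (length F * 2) _) (cong suc (ℕ.+-suc (length F * 2) _))

    -- The count does not depend on the order of F, so h may be added last, where it must still
    -- merge three classes; over fewer triangles its corners are separated all the more.
    forest-split : ∀ {Y F K h} → Forest Y F → h ∈ F → (∀ {k} → k ∈ K → k ∈ F) → h ∉ K → Split (K ▹ Y) h
    forest-split {Y} {F} {K} {h} fF h∈F K⊆F h∉K with ∈-∃++ h∈F
    ... | F₁ , F₂ , refl = Split-antimono (▹-mono K⊆G (⊑-refl Y)) (⇒split (G ▹ Y) le)
      where
      G = F₁ ++ F₂
      K⊆G : ∀ {k} → k ∈ K → k ∈ G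
      K⊆G k∈K with ∈-++⁻ F₁ (K⊆F k∈K)
      ... | inj₁ p            = ∈-++⁺ˡ p
      ... | inj₂ (here refl)  = contradiction k∈K h∉K
      ... | inj₂ (there p)    = ∈-++⁺ʳ F₁ p
      hG⊒ : ∀ {k} → k ∈ F₁ ++ h ∷ F₂ → k ∈ h ∷ G
      hG⊒ k∈ with ∈-++⁻ F₁ k∈
      ... | inj₁ p           = there (∈-++⁺ˡ p)
      ... | inj₂ (here refl) = here refl
      ... | inj₂ (there p)   = there (∈-++⁺ʳ F₁ p)
      len : length (F₁ ++ h ∷ F₂) ≡ suc (length G)
      len = trans (length-++ F₁) (trans (ℕ.+-suc (length F₁) _) (cong suc (sym (length-++ F₁))))
      le : 2 + c ((h ∷ G) ▹ Y) ≤ c (G ▹ Y)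
      le = ℕ.+-cancelˡ-≤ (length G * 2) _ _ (ℕ.≤-trans (ℕ.≤-reflexive
             (trans (ℕ.+-suc (length G * 2) _) (cong suc (ℕ.+-suc (length G * 2) _))))
           (ℕ.≤-trans (ℕ.+-monoʳ-≤ (suc (length G) * 2) (c-antimono (▹-mono {F₁ ++ h ∷ F₂} {h ∷ G} hG⊒ (⊑-refl Y))))
           (ℕ.≤-trans (subst (λ l → l * 2 + c ((F₁ ++ h ∷ F₂) ▹ Y) ≤ c Y) len fF) (c-▹ G Y))))

    -- Exchanging triangles

    last-suffix : ∀ {P : List V → Set} → (∀ M → Dec (P M)) → ∀ M → P [] → ¬ P M →
                  ∃₂ λ M₁ m → ∃ λ M₂ → M ≡ M₁ ++ m ∷ M₂ × P M₂ × ¬ P (m ∷ M₂)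
    last-suffix P? []      p ¬p = contradiction p ¬p
    last-suffix P? (m ∷ M) p ¬p with P? M
    ... | yes p′ = [] , m , M , refl , p′ , ¬p
    ... | no ¬p′ with last-suffix P? M p ¬p′
    ... | M₁ , m′ , M₂ , eq , r = m ∷ M₁ , m′ , M₂ , cong (m ∷_) eq , r

    -- Over X the triangles m and h merge at most three times together, and h alone merges twice, so
    -- m merges at most once after h. On the other side h merges at least once after m and M. Both
    -- sums end at the count for M, m and h together.
    exchange-≤ : ∀ M {X m h} → Split X h → ¬ Split ((m ∷ []) ▹ X) h → ¬ Joined (M ▹ (m ∷ []) ▹ X) h →
                 c (M ▹ (h ∷ []) ▹ X) ≤ c (M ▹ (m ∷ []) ▹ X)
    exchange-≤ M {X} {m} {h} s ¬s ¬j =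
      ℕ.≤-trans (¬split⇒ (M ▹ hX) (λ sm → ¬sm (Split-antimono (▹-⊒ M hX) sm)))
        (ℕ.≤-trans (s≤s (c-antimono hM⊑mM)) (¬joined⇒ (M ▹ mX) ¬j))
      where
      hX mX : Edges
      hX = (h ∷ []) ▹ X
      mX = (m ∷ []) ▹ X
      ¬sm : ¬ Split hX m
      ¬sm sm = ℕ.1+n≰n (ℕ.≤-trans (ℕ.≤-reflexive (sym (trans (split⇒ X s) (cong (2 +_) (split⇒ hX sm)))))
        (ℕ.≤-trans (c-▹₁ X m) (s≤s (s≤s (ℕ.≤-trans (¬split⇒ mX ¬s) (s≤s (c-antimono (push (h ∷ []) m X))))))))
      hM⊑mM : (h ∷ M) ▹ mX ⊑ (m ∷ M) ▹ hX
      hM⊑mM = ▹-⊑ {h ∷ M} {mX} {(m ∷ M) ▹ hX}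
        (λ { (here refl) → Joined-mono (▹-⊒ (m ∷ M) hX) (▹-joined {h ∷ []} X (here refl))
           ; (there k∈M) → ▹-joined {m ∷ M} hX (there k∈M) })
        (▹-⊑ {m ∷ []} {X} {(m ∷ M) ▹ hX} (λ { (here refl) → ▹-joined {m ∷ M} hX (here refl) })
             (⊑-trans (▹-⊒ (h ∷ []) X) (▹-⊒ (m ∷ M) hX)))

    -- If h left p and q apart, h followed by the edge would merge three times; the edge followed by
    -- h merges at most twice.
    closing-edge : ∀ X {p q h} → Split X h → ¬ Split ((p , q) ∷ X) h → (h ∷ []) ▹ X ⊢ p ≈ q
    closing-edge X {p} {q} {h} s ¬s with ⊢? ((h ∷ []) ▹ X) p q
    ... | yes e = e
    ... | no ¬e = contradiction (ℕ.≤-trans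
      (ℕ.≤-reflexive (sym (trans (split⇒ X s) (cong (2 +_) (c-∉ ((h ∷ []) ▹ X) ¬e)))))
      (ℕ.≤-trans (c-∷ X p q) (s≤s (ℕ.≤-trans (¬split⇒ ((p , q) ∷ X) ¬s)
        (s≤s (c-antimono (∷-▹-comm (h ∷ []) (p , q) X))))))) ℕ.1+n≰n

    -- The edge followed by h merges at least twice; if h joined p to q, the two together would
    -- merge no more than h alone, that is, at most once.
    stays-separated : ∀ X {p q h} → ¬ X ⊢ p ≈ q → ¬ Joined ((p , q) ∷ X) h → ¬ Split X h →
                      ¬ (h ∷ []) ▹ X ⊢ p ≈ q
    stays-separated X {p} {q} {h} p≉q ¬j ¬s e = ℕ.1+n≰n
      (ℕ.≤-trans (ℕ.≤-trans (s≤s (¬joined⇒ ((p , q) ∷ X) ¬j)) (ℕ.≤-reflexive (sym (c-∉ X p≉q))))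
      (ℕ.≤-trans (¬split⇒ X ¬s) (s≤s (c-antimono ⊒))))
      where
      ⊒ : (h ∷ []) ▹ (p , q) ∷ X ⊑ (h ∷ []) ▹ X
      ⊒ = ⊑-trans (▹-∷-comm (h ∷ []) (p , q) X) (⊑-∷ˡ e (⊑-refl _))

    -- In `blocked`, h cannot be added as a full triangle even to the triangles K already shared
    -- with T. This is absurd if T is a forest over Y; if T is a forest only over a smaller base, it
    -- shows that h depends on the extra edges of Y.
    data Outcome (Y : Edges) (T : List V) (p q : V) (L C : ℕ) : Set where
      augment : ∀ F h → length F ≡ L → c (F ▹ Y) ≤ C → Split (F ▹ Y) h → Outcome Y T p q L C
      blocked : ∀ F K h → length F ≡ L → c (F ▹ Y) ≤ C → ¬ F ▹ Y ⊢ p ≈ q →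
                (∀ {k} → k ∈ K → k ∈ F × k ∈ T) → h ∈ T →
                ¬ Joined ((p , q) ∷ F ▹ Y) h → ¬ Split (F ▹ Y) h → ¬ Split (K ▹ Y) h → Outcome Y T p q L C
      absorbed : ∀ F → length F ≡ L → c (F ▹ Y) ≤ C → ¬ F ▹ Y ⊢ p ≈ q →
                 (∀ {h} → h ∈ T → Joined ((p , q) ∷ F ▹ Y) h) → Outcome Y T p q L C

    -- A forest separating p from q is moved towards T by exchanges that keep p and q separated: a
    -- triangle h of T that still merges classes after p and q are identified either enlarges the
    -- forest or closes a single cycle, on which a triangle outside T is sacrificed for h.
    exchange : ∀ {Y T p q L C} k M K → length M < k → length M + length K ≡ L → c (M ▹ K ▹ Y) ≤ C → ¬ M ▹ K ▹ Y ⊢ p ≈ q →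
               (∀ {h} → h ∈ K → h ∈ T) → Outcome Y T p q L C
    exchange {Y} {T} {p} {q} {L} {C} (suc k) M K M<k refl le p≉q K⊆T
      with All.all? (Joined? ((p , q) ∷ M ▹ K ▹ Y)) T
    ... | yes js = absorbed (M ++ K) (length-++ M) (subst (λ X → c X ≤ C) (sym (++-▹ M K)) le)
                     (subst (λ X → ¬ X ⊢ p ≈ q) (sym (++-▹ M K)) p≉q)
                     (subst (λ X → ∀ {h} → h ∈ T → Joined ((p , q) ∷ X) h) (sym (++-▹ M K)) (All.lookup js))
    ... | no ¬js with find (¬All⇒Any¬ (Joined? ((p , q) ∷ M ▹ K ▹ Y)) T ¬js)
    ... | h , h∈T , ¬j with Split? (M ▹ K ▹ Y) h
    ... | yes s = augment (M ++ K) h (length-++ M) (subst (λ X → c X ≤ C) (sym (++-▹ M K)) le)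
                    (subst (λ X → Split X h) (sym (++-▹ M K)) s)
    ... | no ¬s with Split? (K ▹ Y) h
    ... | no ¬sK = blocked (M ++ K) K h (length-++ M) (subst (λ X → c X ≤ C) (sym (++-▹ M K)) le)
                     (subst (λ X → ¬ X ⊢ p ≈ q) (sym (++-▹ M K)) p≉q) (λ k∈K → ∈-++⁺ʳ M k∈K , K⊆T k∈K) h∈T
                     (subst (λ X → ¬ Joined ((p , q) ∷ X) h) (sym (++-▹ M K)) ¬j)
                     (subst (λ X → ¬ Split X h) (sym (++-▹ M K)) ¬s) ¬sK
    -- m is a triangle of M at whose addition h stops being split. It leaves M and h enters K, so
    -- the length of M bounds the recursion.
    ... | yes sK with last-suffix (λ M → Split? (M ▹ K ▹ Y) h) M sK ¬s
    ... | M₁ , m , M₂ , refl , s , ¬s₁ =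
      exchange k (M₁ ++ M₂) (h ∷ K) (ℕ.≤-trans (ℕ.≤-reflexive (sym len₁)) (s≤s⁻¹ M<k))
        (trans (ℕ.+-suc _ _) (cong (_+ length K) (sym len₁))) new≤ new≉
        (λ { (here refl) → h∈T ; (there k∈K) → K⊆T k∈K })
      where
      X old new : Edges
      X   = M₂ ▹ K ▹ Y
      old = (M₁ ++ m ∷ M₂) ▹ K ▹ Y
      new = (M₁ ++ M₂) ▹ (h ∷ K) ▹ Y
      old≡ : old ≡ M₁ ▹ (m ∷ []) ▹ X
      old≡ = ++-▹ M₁ (m ∷ M₂)
      len₁ : length (M₁ ++ m ∷ M₂) ≡ suc (length (M₁ ++ M₂))
      len₁ = trans (length-++ M₁) (trans (ℕ.+-suc _ _) (cong suc (sym (length-++ M₁))))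
      swapped⊑new : M₁ ▹ (h ∷ []) ▹ X ⊑ new
      swapped⊑new = ▹-⊑ {M₁} (λ x∈ → ▹-joined {M₁ ++ M₂} ((h ∷ K) ▹ Y) (∈-++⁺ˡ x∈))
        (▹-⊑ {h ∷ []} (λ { (here refl) → Joined-mono (▹-⊒ (M₁ ++ M₂) ((h ∷ K) ▹ Y)) (▹-joined {h ∷ K} Y (here refl)) })
        (▹-⊑ {M₂} (λ x∈ → ▹-joined {M₁ ++ M₂} ((h ∷ K) ▹ Y) (∈-++⁺ʳ M₁ x∈))
        (⊑-trans (⊑-∷ʳ _ (⊑-∷ʳ _ (⊑-refl (K ▹ Y)))) (▹-⊒ (M₁ ++ M₂) ((h ∷ K) ▹ Y)))))
      new⊑h+old : new ⊑ (h ∷ []) ▹ old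
      new⊑h+old = ▹-⊑ {M₁ ++ M₂} (λ x∈ → Joined-mono (▹-⊒ (h ∷ []) old) (▹-joined {M₁ ++ m ∷ M₂} (K ▹ Y) (widen x∈)))
        (⊑-∷ˡ (proj₁ (▹-joined {h ∷ []} old (here refl))) (⊑-∷ˡ (proj₂ (▹-joined {h ∷ []} old (here refl)))
        (⊑-trans (▹-⊒ (M₁ ++ m ∷ M₂) (K ▹ Y)) (▹-⊒ (h ∷ []) old))))
        where
        widen : ∀ {x} → x ∈ M₁ ++ M₂ → x ∈ M₁ ++ m ∷ M₂
        widen x∈ with ∈-++⁻ M₁ x∈
        ... | inj₁ x∈₁ = ∈-++⁺ˡ x∈₁
        ... | inj₂ x∈₂ = ∈-++⁺ʳ M₁ (there x∈₂)
      new≤ : c new ≤ C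
      new≤ = ℕ.≤-trans (c-antimono swapped⊑new) (ℕ.≤-trans
        (exchange-≤ M₁ s ¬s₁ (λ j → ¬j (Joined-mono (⊑-∷ʳ (p , q) (⊑-refl old)) (subst (λ Z → Joined Z h) (sym old≡) j))))
        (subst (λ Z → c Z ≤ C) old≡ le))
      new≉ : ¬ new ⊢ p ≈ q
      new≉ e = stays-separated old p≉q ¬j ¬s (⊑⇒⊆ new⊑h+old e)

-- Orbits of a permutation

least : ∀ {P : ℕ → Set} → (∀ k → Dec (P k)) → ∀ k → P k → ∃ λ m → P m × (∀ i → i < m → ¬ P i)
least P? zero pk = 0 , pk , λ _ ()
least P? (suc k) pk with P? 0
... | yes p0 = 0 , p0 , λ _ ()
... | no ¬p0 with least (P? ∘ suc) k pk
... | m , pm , below = suc m , pm , λ { zero _ → ¬p0 ; (suc i) (s≤s i<m) → below i i<m }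

Injective : {A : Set} → (A → A) → Set
Injective f = ∀ {x y} → f x ≡ f y → x ≡ y

module _ {A : Set} (f : A → A) where

  fold-comm : ∀ i j x → fold (fold x f i) f j ≡ fold (fold x f j) f i
  fold-comm i j x = trans (sym (fold-+ x f j)) (trans (cong (fold x f) (ℕ.+-comm j i)) (fold-+ x f i))

  fold-shift : ∀ i x → fold (f x) f i ≡ f (fold x f i)
  fold-shift i x = fold-comm 1 i x

  fold-periodic : ∀ d k {x} → fold x f d ≡ x → fold x f (k * d) ≡ x
  fold-periodic d zero    p = refl
  fold-periodic d (suc k) {x} p = trans (fold-+ x f d) (trans (cong (λ y → fold y f d) (fold-periodic d k p)) p)

  fold-injective : Injective f → ∀ i {x y} → fold x f i ≡ fold y f i → x ≡ y
  fold-injective inj zero    e = e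
  fold-injective inj (suc i) e = fold-injective inj i (inj e)

module Orbit {n : ℕ} (f : Fin n → Fin n) (f-injective : Injective f) where

  private
    V = Fin n

  infix 4 _~_
  _~_ : V → V → Set
  x ~ y = ∃ λ k → fold x f k ≡ y

  collision : ∀ i j x → i < j → fold x f i ≡ fold x f j → 0 < j ∸ i × fold x f (j ∸ i) ≡ x
  collision i j x i<j e = ℕ.m<n⇒0<n∸m i<j , fold-injective f f-injective i (trans
    (sym (trans (cong (fold x f) (sym (ℕ.m+[n∸m]≡n (ℕ.<⇒≤ i<j)))) (fold-+ x f i))) (sym e))

  period : ∀ x → ∃ λ d → 0 < d × d ≤ n × fold x f d ≡ x
  period x with pigeonhole (ℕ.n<1+n n) (λ i → fold x f (toℕ i))
  ... | i , j , i<j , e with collision (toℕ i) (toℕ j) x i<j e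
  ... | 0<d , p = toℕ j ∸ toℕ i , 0<d , ℕ.≤-trans (ℕ.m∸n≤m (toℕ j) (toℕ i)) (s≤s⁻¹ (toℕ<n j)) , p

  fold-mod : ∀ {d x} .{{_ : NonZero d}} → fold x f d ≡ x → ∀ k → fold x f (k % d) ≡ fold x f k
  fold-mod {d} {x} p k = sym (trans (cong (fold x f) (m≡m%n+[m/n]*n k d))
    (trans (fold-+ x f (k % d)) (cong (λ y → fold y f (k % d)) (fold-periodic f d (k / d) p))))

  ~⇒bounded : ∀ {x y} → x ~ y → ∃ λ (i : Fin n) → fold x f (toℕ i) ≡ y
  ~⇒bounded {x} (k , e) with period x
  ... | d@(suc _) , _ , d≤n , p = fromℕ< k%d<n , trans (cong (fold x f) (toℕ-fromℕ< k%d<n)) (trans (fold-mod p k) e)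
    where
    k%d<n : k % d < n
    k%d<n = ℕ.<-≤-trans (m%n<n k d) d≤n

  ~-refl : ∀ {x} → x ~ x
  ~-refl = 0 , refl

  ~-trans : ∀ {x y z} → x ~ y → y ~ z → x ~ z
  ~-trans {x} (k , refl) (l , refl) = l + k , fold-+ x f l

  ~-sym : ∀ {x y} → x ~ y → y ~ x
  ~-sym {x} (k , refl) with period x
  ... | d@(suc _) , _ , _ , p = d ∸ k % d , trans (cong (λ y → fold y f (d ∸ k % d)) (sym (fold-mod p k)))
    (trans (sym (fold-+ x f (d ∸ k % d))) (trans (cong (fold x f) (ℕ.m∸n+n≡m (ℕ.<⇒≤ (m%n<n k d)))) p))

  ~-step : ∀ {x} → x ~ f x
  ~-step = 1 , refl

  ~-isEquivalence : IsEquivalence _~_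
  ~-isEquivalence = record { refl = ~-refl ; sym = ~-sym ; trans = ~-trans }

  ~-least : ∀ {S : V → V → Set} → IsEquivalence S → (∀ x → S x (f x)) → ∀ {x y} → x ~ y → S x y
  ~-least eq st (zero  , refl) = IsEquivalence.refl eq
  ~-least eq st (suc k , refl) = IsEquivalence.trans eq (~-least eq st (k , refl)) (st _)

  abstract
    ~-isDecEquivalence : IsDecEquivalence _~_
    ~-isDecEquivalence = record
      { isEquivalence = ~-isEquivalence
      ; _≟_ = λ x y → map′ (λ { (i , e) → toℕ i , e }) ~⇒bounded (any? λ i → fold x f (toℕ i) ≟ y) }

  orbits : DecEquivalence V
  orbits = record { _≈_ = _~_ ; isDecEquivalence = ~-isDecEquivalence }

  -- Representative of the orbit and exponent below k are coordinates on `V`, since every orbit has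
  -- exactly k elements.
  orbit-count : ∀ k → (∀ x → fold x f k ≡ x) → (∀ x i → 0 < i → i < k → fold x f i ≢ x) → 0 < k →
                (# orbits) * k ≡ n
  orbit-count k@(suc _) p free _ = ℕ.≤-antisym
    (injective⇒≤ {f = λ z → element (remQuot k z)} λ {z} {w} e → trans (sym (combine-remQuot {# orbits} k z))
       (trans (cong (λ { (i , j) → combine i j }) (element-injective (remQuot k z) (remQuot k w) e))
              (combine-remQuot {# orbits} k w)))
    (injective⇒≤ {f = code} λ {x} {y} e → let e₁ , e₂ = combine-injective _ _ _ _ e in
       trans (sym (decode x)) (trans (cong₂ (λ i j → element (i , j)) e₁ e₂) (decode y)))
    where
    open Transversal (#-transversal orbits)
    element : Fin (# orbits) × Fin k → V
    element (i , j) = fold (rep i) f (toℕ j)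
    exponent-unique : ∀ x i j → i < k → j < k → fold x f i ≡ fold x f j → i ≡ j
    exponent-unique x i j i<k j<k e with ℕ.<-cmp i j
    ... | tri≈ _ i≡j _ = i≡j
    ... | tri< i<j _ _ = let 0<d , q = collision i j x i<j e in contradiction q (free x _ 0<d (ℕ.≤-<-trans (ℕ.m∸n≤m j i) j<k))
    ... | tri> _ _ j<i = let 0<d , q = collision j i x j<i (sym e) in contradiction q (free x _ 0<d (ℕ.≤-<-trans (ℕ.m∸n≤m i j) i<k))
    element-injective : ∀ z w → element z ≡ element w → z ≡ w
    element-injective (i , j) (i′ , j′) e with distinct {i} {i′} (~-trans (toℕ j , e) (~-sym (toℕ j′ , refl)))
    ... | refl = cong (i ,_) (toℕ-injective (exponent-unique (rep i) _ _ (toℕ<n j) (toℕ<n j′) e))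
    exponent : ∀ x → ∃ λ m → fold (rep (proj₁ (cover x))) f m ≡ x
    exponent x = ~-sym (proj₂ (cover x))
    exponent% : V → Fin k
    exponent% x = fromℕ< (m%n<n (proj₁ (exponent x)) k)
    code : V → Fin ((# orbits) * k)
    code x = combine (proj₁ (cover x)) (exponent% x)
    decode : ∀ x → element (proj₁ (cover x) , exponent% x) ≡ x
    decode x = trans (cong (fold (rep (proj₁ (cover x))) f) (toℕ-fromℕ< (m%n<n (proj₁ (exponent x)) k)))
      (trans (fold-mod (p (rep (proj₁ (cover x)))) (proj₁ (exponent x))) (proj₂ (exponent x)))

-- Composition with a transposition

swap : ∀ {n} → Fin n → Fin n → Fin n → Fin n
swap p q x with x ≟ p
... | yes _ = q
... | no _ with x ≟ q
... | yes _ = p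
... | no _  = x

module _ {n : ℕ} (p q : Fin n) where

  swapˡ : swap p q p ≡ q
  swapˡ with p ≟ p
  ... | yes _ = refl
  ... | no ¬e = contradiction refl ¬e

  swapʳ : swap p q q ≡ p
  swapʳ with q ≟ p
  ... | yes e = e
  ... | no _ with q ≟ q
  ... | yes _ = refl
  ... | no ¬e = contradiction refl ¬e

  swap-fix : ∀ {x} → x ≢ p → x ≢ q → swap p q x ≡ x
  swap-fix {x} x≢p x≢q with x ≟ p
  ... | yes e = contradiction e x≢p
  ... | no _ with x ≟ q
  ... | yes e = contradiction e x≢q
  ... | no _  = refl

  swap-involutive : ∀ x → swap p q (swap p q x) ≡ x
  swap-involutive x with x ≟ p
  ... | yes refl = swapʳ
  ... | no x≢p with x ≟ q
  ... | yes refl = swapˡ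
  ... | no x≢q = swap-fix x≢p x≢q

  swap-injective : ∀ {x y} → swap p q x ≡ swap p q y → x ≡ y
  swap-injective {x} {y} e = trans (sym (swap-involutive x)) (trans (cong (swap p q) e) (swap-involutive y))

module Transposition {n : ℕ} (f : Fin n → Fin n) (f-injective : Injective f) (p q : Fin n) where

  private
    V = Fin n

  f′ : V → V
  f′ x = f (swap p q x)

  f′-injective : Injective f′
  f′-injective e = swap-injective p q (f-injective e)

  private
    module O  = Orbit f f-injective
    module O′ = Orbit f′ f′-injective

  f′p : f′ p ≡ f q
  f′p = cong f (swapˡ p q)

  f′q : f′ q ≡ f p
  f′q = cong f (swapʳ p q)

  f′-fix : ∀ {x} → x ≢ p → x ≢ q → f′ x ≡ f x
  f′-fix x≢p x≢q = cong f (swap-fix p q x≢p x≢q)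

  -- Following f′ from r copies the f-orbit of r until that orbit returns to r or meets t.
  follow : ∀ r t → (∀ {x} → x ≢ r → x ≢ t → f′ x ≡ f x) → ¬ r O.~ t → f r O′.~ r
  follow r t fix r≁t with O.period r
  ... | suc d , _ , _ , e = go d (f r) O.~-step (trans (fold-shift f d r) e)
    where
    go : ∀ d x → r O.~ x → fold x f d ≡ r → x O′.~ r
    go zero    x _   refl = O′.~-refl
    go (suc d) x r~x e with x ≟ r
    ... | yes refl = O′.~-refl
    ... | no x≢r = O′.~-trans (1 , fix x≢r (λ { refl → r≁t r~x }))
                     (go d (f x) (O.~-trans r~x O.~-step) (trans (fold-shift f d x) e))

  f′-step : ∀ {S : V → V → Set} → IsEquivalence S → (∀ x → S x (f x)) → S p q → ∀ x → S x (f′ x)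
  f′-step eq st pq x with x ≟ p
  ... | yes refl = IsEquivalence.trans eq pq (st q)
  ... | no x≢p with x ≟ q
  ... | yes refl = IsEquivalence.trans eq (IsEquivalence.sym eq pq) (st p)
  ... | no x≢q = st x

  module _ (p≁q : ¬ p O.~ q) where

    merges : p O′.~ q
    merges = O′.~-trans O′.~-step (subst (O′._~ q) (sym f′p) (follow q p (λ x≢q x≢p → f′-fix x≢p x≢q) (p≁q ∘ O.~-sym)))

    preserves : ∀ {x y} → x O.~ y → x O′.~ y
    preserves = O.~-least O′.~-isEquivalence step
      where
      step : ∀ x → x O′.~ f x
      step x with x ≟ p
      ... | yes refl = O′.~-trans merges (subst (q O′.~_) f′q O′.~-step)
      ... | no x≢p with x ≟ q
      ... | yes refl = O′.~-trans (O′.~-sym merges) (subst (p O′.~_) f′p O′.~-step)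
      ... | no x≢q = subst (x O′.~_) (f′-fix x≢p x≢q) O′.~-step

    merge-count : # O.orbits ≡ suc (# O′.orbits)
    merge-count = trans (#-join-∉ O.orbits p≁q) (cong suc (ℕ.≤-antisym
      (#-antimono O′.orbits joined (O′.~-least isEquivalence
        (f′-step isEquivalence (λ _ → inj₁ O.~-step) (inj₂ (inj₁ (O.~-refl , O.~-refl))))))
      (#-antimono joined O′.orbits (join-least O.orbits O′.~-isEquivalence preserves merges))))
      where
      joined = join O.orbits p q
      open IsDecEquivalence (DecEquivalence.isDecEquivalence joined) using (isEquivalence)

  module _ (p≢q : p ≢ q) (p~q : p O.~ q) where

    -- With m the least exponent leading from p to q, the arc from `f p` to q misses p and is closed
    -- under `f′`, because `f′ q` is `f p`.
    separates : ¬ q O′.~ p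
    separates q~p with least (λ k → fold p f k ≟ q) (proj₁ p~q) (proj₂ p~q)
    ... | zero , p≡q , _ = p≢q p≡q
    ... | m@(suc _) , fᵐp≡q , below = no-return (Inv-closed q~p (m , s≤s z≤n , ℕ.≤-refl , fᵐp≡q))
      where
      Inv : V → Set
      Inv x = ∃ λ i → 0 < i × i ≤ m × fold p f i ≡ x
      no-return : ¬ Inv p
      no-return (i , 0<i , i≤m , e) with ℕ.m≤n⇒m<n∨m≡n i≤m
      ... | inj₂ refl = p≢q (trans (sym e) fᵐp≡q)
      ... | inj₁ i<m = below (m ∸ i) (ℕ.∸-monoʳ-< 0<i i≤m) (trans (cong (λ x → fold x f (m ∸ i)) (sym e))
            (trans (sym (fold-+ p f (m ∸ i))) (trans (cong (fold p f) (ℕ.m∸n+n≡m i≤m)) fᵐp≡q)))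
      Inv-step : ∀ {x} → Inv x → Inv (f′ x)
      Inv-step {x} (i , 0<i , i≤m , e) with x ≟ p
      ... | yes refl = contradiction (i , 0<i , i≤m , e) no-return
      ... | no x≢p with x ≟ q
      ... | yes refl = 1 , s≤s z≤n , s≤s z≤n , refl
      ... | no x≢q with ℕ.m≤n⇒m<n∨m≡n i≤m
      ... | inj₁ i<m = suc i , s≤s z≤n , i<m , cong f e
      ... | inj₂ refl = contradiction (trans (sym e) fᵐp≡q) x≢q
      Inv-closed : ∀ {x y} → x O′.~ y → Inv x → Inv y
      Inv-closed (zero  , refl) i = i
      Inv-closed (suc k , refl) i = Inv-step (Inv-closed (k , refl) i)

orbits-cong-≤ : ∀ {n} {f g : Fin n → Fin n} (f-inj : Injective f) (g-inj : Injective g) → (∀ x → f x ≡ g x) →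
              # Orbit.orbits g g-inj ≤ # Orbit.orbits f f-inj
orbits-cong-≤ {f = f} {g} f-inj g-inj f≗g = #-antimono (Orbit.orbits f f-inj) (Orbit.orbits g g-inj)
  (Orbit.~-least f f-inj (Orbit.~-isEquivalence g g-inj)
    λ x → subst (Orbit._~_ g g-inj x) (sym (f≗g x)) (Orbit.~-step g g-inj))

orbits-cong : ∀ {n} {f g : Fin n → Fin n} (f-inj : Injective f) (g-inj : Injective g) → (∀ x → f x ≡ g x) →
              # Orbit.orbits f f-inj ≡ # Orbit.orbits g g-inj
orbits-cong f-inj g-inj f≗g =
  ℕ.≤-antisym (orbits-cong-≤ g-inj f-inj (λ x → sym (f≗g x))) (orbits-cong-≤ f-inj g-inj f≗g)

-- If p and q share an orbit of f, they lie in different orbits of `f′`, and the same transposition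
-- leads back from `f′` to f. So the merging count settles both cases.
transposition-parity : ∀ {n} (f : Fin n → Fin n) (f-inj : Injective f) {p q} → p ≢ q →
  parity (# Orbit.orbits f f-inj) ≡
  parity (# Orbit.orbits (Transposition.f′ f f-inj p q) (Transposition.f′-injective f f-inj p q)) ⁻¹
transposition-parity f f-inj {p} {q} p≢q with DecEquivalence._≈?_ (Orbit.orbits f f-inj) p q
... | no p≁q = trans (cong parity (T.merge-count p≁q)) (flip (# Orbit.orbits T.f′ T.f′-injective))
  where
  module T = Transposition f f-inj p q
  flip : ∀ k → parity (suc k) ≡ parity k ⁻¹
  flip k = trans (sym (ℙ.⁻¹-involutive (parity (suc k)))) (cong _⁻¹ (ℙ.suc-homo-⁻¹ k))
... | yes p~q = trans (sym (ℙ.suc-homo-⁻¹ (# Orbit.orbits f f-inj))) (cong (λ k → parity k ⁻¹)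
    (sym (trans (T′.merge-count p≁q) (cong suc (orbits-cong T′.f′-injective f-inj (λ x → cong f (swap-involutive p q x)))))))
  where
  module T = Transposition f f-inj p q
  module T′ = Transposition T.f′ T.f′-injective p q
  p≁q : ¬ Orbit._~_ T.f′ T.f′-injective p q
  p≁q e = T.separates p≢q p~q (Orbit.~-sym T.f′ T.f′-injective e)

-- Regular triangulations

-- The elements of Fin n are the darts, and A, B are right multiplication by a, b. The vertices of the
-- triangulation are the B-orbits, and the corners of the triangle h are the orbits of h, β h, β (β h).
record Automorphism {n : ℕ} (A B : Fin n → Fin n) : Set where
  field
    θ θ⁻¹  : Fin n → Fin n
    θθ⁻¹   : ∀ x → θ (θ⁻¹ x) ≡ x
    θ⁻¹θ   : ∀ x → θ⁻¹ (θ x) ≡ x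
    θ-A    : ∀ x → θ (A x) ≡ A (θ x)
    θ-B    : ∀ x → θ (B x) ≡ B (θ x)

  inverse : Automorphism A B
  inverse = record
    { θ = θ⁻¹ ; θ⁻¹ = θ ; θθ⁻¹ = θ⁻¹θ ; θ⁻¹θ = θθ⁻¹
    ; θ-A = λ x → trans (cong (λ y → θ⁻¹ (A y)) (sym (θθ⁻¹ x))) (trans (cong θ⁻¹ (sym (θ-A (θ⁻¹ x)))) (θ⁻¹θ _))
    ; θ-B = λ x → trans (cong (λ y → θ⁻¹ (B y)) (sym (θθ⁻¹ x))) (trans (cong θ⁻¹ (sym (θ-B (θ⁻¹ x)))) (θ⁻¹θ _)) }

  θ-AB : ∀ x → θ (A (B x)) ≡ A (B (θ x))
  θ-AB x = trans (θ-A (B x)) (cong A (θ-B x))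

  θ-fold : ∀ k x → θ (fold x B k) ≡ fold (θ x) B k
  θ-fold zero    x = refl
  θ-fold (suc k) x = trans (θ-B _) (cong B (θ-fold k x))

-- `translate` is the transitivity of left multiplication, which commutes with `A` and `B`.
-- `connected` is generation by a and b, phrased as induction for equivalence relations so that it
-- applies to classes and to dependence alike.
record RegularMap (n : ℕ) : Set₁ where
  field
    A B B⁻¹ : Fin n → Fin n
    A²      : ∀ x → A (A x) ≡ x
    BB⁻¹    : ∀ x → B (B⁻¹ x) ≡ x
    B⁻¹B    : ∀ x → B⁻¹ (B x) ≡ x

  β : Fin n → Fin n
  β x = A (B x)

  field
    β³       : ∀ x → β (β (β x)) ≡ x
    β-free   : ∀ x → β x ≢ x
    A-free   : ∀ x → A x ≢ x

  field
    translate : ∀ x y → Σ (Automorphism A B) λ t → Automorphism.θ t x ≡ y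
    connected : ∀ {S : Fin n → Fin n → Set} → IsEquivalence S → (∀ x → S x (A x)) → (∀ x → S x (B x)) →
                ∀ x y → S x y

-- Maximum forests and dependence of edges

list-search : ∀ {n} k {P : List (Fin n) → Set} → (∀ xs → Dec (P xs)) → Dec (∃ λ xs → length xs ≡ k × P xs)
list-search zero    P? = map′ (λ p → [] , refl , p) (λ { ([] , _ , p) → p }) (P? [])
list-search (suc k) P? = map′ (λ { (x , xs , e , p) → x ∷ xs , cong suc e , p })
  (λ { (x ∷ xs , e , p) → x , xs , ℕ.suc-injective e , p })
  (any? λ x → list-search k (λ xs → P? (x ∷ xs)))

module Forests {n : ℕ} (M : RegularMap n) where
  open RegularMap M

  private
    V = Fin n

  B-injective : Injective B
  B-injective {x} {y} e = trans (sym (B⁻¹B x)) (trans (cong B⁻¹ e) (B⁻¹B y))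

  module ⟨B⟩ = Orbit B B-injective
  open Span ⟨B⟩.orbits public
  open Triangles β public
  open _⊑_ public

  ⊢-B : ∀ X x → X ⊢ x ≈ B x
  ⊢-B X x = ⊢-base X ⟨B⟩.~-step

  ⊢-fold : ∀ X x k → X ⊢ x ≈ fold x B k
  ⊢-fold X x k = ⊢-base X (k , refl)

  B≡Aβ : ∀ x → B x ≡ A (β x)
  B≡Aβ x = sym (A² (B x))

  A≡Bββ : ∀ x → A x ≡ B (β (β x))
  A≡Bββ x = trans (cong A (sym (β³ x))) (A² _)

  module _ (t : Automorphism A B) where
    open Automorphism t

    translate-⊢ : ∀ F {x y} → F ▹ [] ⊢ x ≈ y → map θ F ▹ [] ⊢ θ x ≈ θ y
    translate-⊢ F = span-least (F ▹ [])
      (record { refl = ⊢-refl F′ ; sym = ⊢-sym F′ ; trans = ⊢-trans F′ })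
      (λ { {x} (k , refl) → subst (F′ ⊢ θ x ≈_) (sym (θ-fold k x)) (⊢-fold F′ (θ x) k) })
      (▹-all {F} (λ {h} h∈F → let e , f = ▹-joined {map θ F} [] (∈-map⁺ θ h∈F) in
          subst (F′ ⊢ θ h ≈_) (sym (θ-AB h)) e
        , subst₂ (F′ ⊢_≈_) (sym (θ-AB h)) (sym (trans (θ-AB (β h)) (cong β (θ-AB h)))) f) [])
      where
      F′ = map θ F ▹ []

  translate-⊢⁻ : ∀ t F {x y} → let open Automorphism t in map θ F ▹ [] ⊢ θ x ≈ θ y → F ▹ [] ⊢ x ≈ y
  translate-⊢⁻ t F {x} {y} e = subst₂ (F ▹ [] ⊢_≈_) (θ⁻¹θ x) (θ⁻¹θ y)
    (subst (λ G → G ▹ [] ⊢ θ⁻¹ (θ x) ≈ θ⁻¹ (θ y)) (trans (sym (map-∘ F)) (trans (map-cong θ⁻¹θ F) (map-id F)))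
      (translate-⊢ inverse (map θ F) e))
    where open Automorphism t

  translate-forest : ∀ t F → Forest [] F → Forest [] (map (Automorphism.θ t) F)
  translate-forest t []      fF = ℕ.≤-refl
  translate-forest t (h ∷ F) fF with forest-∷⁻ {[]} {F} fF
  ... | fF′ , e , f , g = forest-∷⁺ {[]} {map θ F} (translate-forest t F fF′)
    ( e ∘ translate-⊢⁻ t F ∘ subst (F′ ⊢ θ h ≈_) (sym (θ-AB h))
    , f ∘ translate-⊢⁻ t F ∘ subst₂ (F′ ⊢_≈_) (sym (θ-AB h)) (sym ββ)
    , g ∘ translate-⊢⁻ t F ∘ subst (F′ ⊢ θ h ≈_) (sym ββ))
    where
    open Automorphism t
    F′ = map θ F ▹ []
    ββ : θ (β (β h)) ≡ β (β (θ h))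
    ββ = trans (θ-AB (β h)) (cong β (θ-AB h))

  c-connected : ∀ X → (∀ x → X ⊢ x ≈ A x) → c X ≤ 1
  c-connected X conn = ℕ.≤-trans (ℕ.≤-reflexive (c-≡ X))
    (#-total (span X) (connected (⊢-isEquivalence X) conn (⊢-B X)))

  separated-edge : ∀ X → 2 ≤ c X → ∃ λ x → ¬ X ⊢ x ≈ A x
  separated-edge X 2≤c = ¬∀⟶∃¬ n _ (λ x → ⊢? X x (A x)) λ conn → ℕ.1+n≰n (ℕ.≤-trans 2≤c (c-connected X conn))

  Maximum : ℕ → Set
  Maximum ν = ∀ F → length F ≡ suc ν → ¬ Forest [] F

  -- A failure of maximality yields a longer forest, and no forest has more than `c []` triangles,
  -- which bounds the search.
  maximum-forest : ∃ λ F → Forest [] F × Maximum (length F)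
  maximum-forest = go (c []) [] (ℕ.m≤m+n _ 0) ℕ.≤-refl
    where
    go : ∀ fuel F → c [] ≤ fuel + length F → Forest [] F → ∃ λ F → Forest [] F × Maximum (length F)
    go fuel F le fF with list-search (suc (length F)) (λ G → length G * 2 + c (G ▹ []) ℕ.≤? c [])
    ... | no ¬p = F , fF , λ G e fG → ¬p (G , e , fG)
    go (suc fuel) F le fF | yes (G , e , fG) =
      go fuel G (ℕ.≤-trans le (ℕ.≤-reflexive (trans (sym (ℕ.+-suc fuel _)) (cong (fuel +_) (sym e))))) fG
    go zero F le fF | yes (G , e , fG) = contradiction
      (ℕ.≤-trans (ℕ.≤-trans (ℕ.≤-trans (ℕ.≤-reflexive (sym e)) (ℕ.≤-trans (ℕ.m≤m*n (length G) 2) (ℕ.m≤m+n _ _))) fG) le)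
      ℕ.1+n≰n

  module MaximumForests {ν : ℕ} (maximum : Maximum ν) (C : ℕ) (c≡ : c [] ≡ ν * 2 + C) where

    -- Any ν triangles leave at least C classes, so the upper bound alone makes F a forest, of
    -- maximum size.
    record Optimal (F : List V) : Set where
      constructor optimal
      field
        size  : length F ≡ ν
        bound : c (F ▹ []) ≤ C

      forest : Forest [] F
      forest = ℕ.≤-trans (ℕ.+-mono-≤ (ℕ.≤-reflexive (cong (_* 2) size)) bound) (ℕ.≤-reflexive (sym c≡))

      C≤c : C ≤ c (F ▹ [])
      C≤c = ℕ.+-cancelˡ-≤ (ν * 2) _ _ (ℕ.≤-trans (ℕ.≤-reflexive (sym c≡))
        (subst (λ l → c [] ≤ l * 2 + c (F ▹ [])) size (c-▹ F [])))

      unsplit : ∀ h → ¬ Split (F ▹ []) h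
      unsplit h s = maximum (h ∷ F) (cong suc size) (forest-∷⁺ {[]} {F} forest s)

    open Optimal

    forest⇒optimal : ∀ {F} → Forest [] F → length F ≡ ν → Optimal F
    forest⇒optimal {F} fF size = optimal size (ℕ.+-cancelˡ-≤ (ν * 2) _ _
      (ℕ.≤-trans (ℕ.≤-reflexive (cong (λ l → l * 2 + c (F ▹ [])) (sym size))) (ℕ.≤-trans fF (ℕ.≤-reflexive c≡))))

    translate-optimal : ∀ t {F} → Optimal F → Optimal (map (Automorphism.θ t) F)
    translate-optimal t {F} o = forest⇒optimal (translate-forest t F (forest o)) (trans (length-map _ F) (size o))

    Separable : V → Set
    Separable x = ∃ λ F → Optimal F × ¬ F ▹ [] ⊢ x ≈ A x

    translate-separable : ∀ {x} → Separable x → ∀ y → Separable y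
    translate-separable {x} (F , o , x≉Ax) y with translate x y
    ... | t , refl = map θ F , translate-optimal t o
                   , x≉Ax ∘ translate-⊢⁻ t F ∘ subst (map θ F ▹ [] ⊢ θ x ≈_) (sym (θ-A x))
      where open Automorphism t

    Independent : V → V → Set
    Independent x y = ∃ λ F → Optimal F × ¬ F ▹ [] ⊢ x ≈ A x × ¬ (x , A x) ∷ F ▹ [] ⊢ y ≈ A y

    independent-sym : ∀ {x y} → Independent x y → Independent y x
    independent-sym {x} {y} (F , o , x≉ , y≉) = F , o , y≉ ∘ inj₁ , λ
      { (inj₁ e) → x≉ e
      ; (inj₂ (inj₁ (e , f))) → y≉ (inj₂ (inj₁ (⊢-sym (F ▹ []) e , ⊢-sym (F ▹ []) f)))
      ; (inj₂ (inj₂ (e , f))) → y≉ (inj₂ (inj₂ (f , e))) }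

    -- Transitivity of dependence, in positive form. A forest separating the ends of the edge at y
    -- is moved towards T until it absorbs T up to that edge. If it then also joined the edges at x
    -- and z, one merge beyond a maximum forest would achieve what costs T two.
    independent-split : ∀ {x z} y → Separable y → Independent x z → Independent y x ⊎ Independent y z
    independent-split {x} {z} y (F , oF , y≉) (T , oT , x≉ , z≉)
      with exchange {[]} {T} (suc (length F)) F [] ℕ.≤-refl
             (trans (ℕ.+-identityʳ _) (size oF)) (bound oF) y≉ (λ ())
    ... | augment G h |G| cG s = contradiction s (unsplit (optimal |G| cG) h)
    ... | blocked G K h |G| cG _ K⊆ h∈T ¬j _ ¬sK = contradiction
      (forest-split {[]} {T} {K} (forest oT) h∈T (proj₂ ∘ K⊆)
        (λ h∈K → ¬j (Joined-mono (⊑-∷ʳ _ (⊑-refl (G ▹ []))) (▹-joined {G} [] (proj₁ (K⊆ h∈K)))))) ¬sK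
    ... | absorbed G |G| cG y≉G T⊆ with ⊢? ((y , A y) ∷ G ▹ []) x (A x) | ⊢? ((y , A y) ∷ G ▹ []) z (A z)
    ... | no x≉G | _ = inj₁ (G , optimal |G| cG , y≉G , x≉G)
    ... | yes _ | no z≉G = inj₂ (G , optimal |G| cG , y≉G , z≉G)
    ... | yes e | yes f = contradiction (ℕ.≤-trans
      (ℕ.≤-trans (ℕ.≤-reflexive (sym (trans (c-∉ (T ▹ []) x≉) (cong suc (c-∉ ((x , A x) ∷ T ▹ []) z≉)))))
        (ℕ.≤-trans (bound oT) (C≤c (optimal |G| cG))))
      (ℕ.≤-trans (ℕ.≤-reflexive (c-∉ (G ▹ []) y≉G)) (s≤s (c-antimono T⊑)))) ℕ.1+n≰n
      where
      T⊑ : (z , A z) ∷ (x , A x) ∷ T ▹ [] ⊑ (y , A y) ∷ G ▹ []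
      T⊑ = ⊑-∷ˡ f (⊑-∷ˡ e (▹-⊑ {T} T⊆ ⊑-[]))

    dependent-A : ∀ x → ¬ Independent x (A x)
    dependent-A x (F , _ , _ , Ax≉) = Ax≉ (subst ((x , A x) ∷ F ▹ [] ⊢ A x ≈_) (sym (A² x))
      (⊢-sym ((x , A x) ∷ F ▹ []) (⊢-head (F ▹ []))))

    -- The two edges are sides of the triangle g. If the second stays separated after the first is
    -- joined, the three corners lie in three classes and g could be added to the forest.
    dependent-triangle : ∀ g → ¬ Independent (B g) (B (β g))
    dependent-triangle g (F , o , e≉ , f≉) = unsplit o g
      ( (λ e → e≉ (⊢-trans X (⊢-sym X (⊢-B X g)) e))
      , (λ f → f≉ (inj₁ (⊢-trans X (⊢-sym X (⊢-B X (β g))) f)))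
      , (λ e → f≉ (⊢-trans X′ (⊢-sym X′ (⊢-B X′ (β g))) (⊢-trans X′ (⊢-sym X′ (⊢-head X))
                  (⊢-trans X′ (⊢-sym X′ (⊢-B X′ g)) (inj₁ e))))) )
      where
      X X′ : Edges
      X = F ▹ []
      X′ = (B g , A (B g)) ∷ X

    -- Dependence is an equivalence, as every edge is separable, and it relates consecutive edges
    -- of a triangle; by connectedness all edges are dependent, so two classes remain at most.
    C≤2 : ∀ {F} → Optimal F → C ≤ 2
    C≤2 {F} o with C ℕ.≤? 2
    ... | yes le = le
    ... | no  nle = ⊥-elim (all-dependent x y (F , o , x≉ , y≉))
      where
      3≤C : 3 ≤ c (F ▹ [])
      3≤C = ℕ.≤-trans (ℕ.≰⇒> nle) (C≤c o)
      x-sep = separated-edge (F ▹ []) (ℕ.≤-trans (s≤s (s≤s z≤n)) 3≤C)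
      x = proj₁ x-sep
      x≉ = proj₂ x-sep
      y-sep = separated-edge ((x , A x) ∷ F ▹ []) (s≤s⁻¹ (ℕ.≤-trans 3≤C (ℕ.≤-reflexive (c-∉ (F ▹ []) x≉))))
      y = proj₁ y-sep
      y≉ = proj₂ y-sep
      separable : ∀ z → Separable z
      separable = translate-separable (F , o , x≉)
      all-dependent : ∀ x y → ¬ Independent x y
      all-dependent = connected {λ x y → ¬ Independent x y}
        (record
          { refl  = λ { (G , _ , _ , x≉) → x≉ (⊢-head (G ▹ [])) }
          ; sym   = λ d i → d (independent-sym i)
          ; trans = λ {_} {y} d e i → [ d ∘ independent-sym , e ]′ (independent-split y (separable y) i) })
        dependent-A
        -- The passage from x to `B x` goes through `A x`: the edges at `A x` and `B x` are sides of
        -- the triangle `B⁻¹ (A x)`.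
        (λ x i → [ dependent-A x ∘ independent-sym
                 , subst₂ (λ u v → ¬ Independent u v) (BB⁻¹ (A x)) (cong B (βBA x)) (dependent-triangle (B⁻¹ (A x))) ]′
                 (independent-split (A x) (separable (A x)) i))
        where
        βBA : ∀ x → β (B⁻¹ (A x)) ≡ x
        βBA x = trans (cong A (BB⁻¹ (A x))) (A² x)

  -- Toggling triangles

  ββ-free : ∀ x → β (β x) ≢ x
  ββ-free x e = β-free x (trans (sym (cong β e)) (β³ x))

  module Toggle (f : V → V) (f-injective : Injective f) (h : V) where

    module T₁ = Transposition f f-injective h (β h)
    module T₂ = Transposition T₁.f′ T₁.f′-injective h (β (β h))

    -- The two transpositions precompose f with `β ∘ β` on the three darts of the triangle. As `A x`
    -- is `B (β (β x))`, this turns `B` into `A` there.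
    toggled : V → V
    toggled = T₂.f′

    toggled-injective : Injective toggled
    toggled-injective = T₂.f′-injective

    toggled-h : toggled h ≡ f (β (β h))
    toggled-h = trans T₂.f′p (T₁.f′-fix (ββ-free h) (β-free (β h)))

    toggled-βh : toggled (β h) ≡ f h
    toggled-βh = trans (T₂.f′-fix (β-free h) (β-free (β h) ∘ sym)) T₁.f′q

    toggled-ββh : toggled (β (β h)) ≡ f (β h)
    toggled-ββh = trans T₂.f′q T₁.f′p

    toggled-fix : ∀ {x} → x ≢ h → x ≢ β h → x ≢ β (β h) → toggled x ≡ f x
    toggled-fix e₁ e₂ e₃ = trans (T₂.f′-fix e₁ e₃) (T₁.f′-fix e₁ e₂)

    module _ (off₁ : f h ≡ B h) (off₂ : f (β h) ≡ B (β h)) (off₃ : f (β (β h)) ≡ B (β (β h))) where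

      on₁ : toggled h ≡ A h
      on₁ = trans toggled-h (trans off₃ (sym (A≡Bββ h)))

      on₂ : toggled (β h) ≡ A (β h)
      on₂ = trans toggled-βh (trans off₁ (B≡Aβ h))

      on₃ : toggled (β (β h)) ≡ A (β (β h))
      on₃ = trans toggled-ββh (trans off₂ (B≡Aβ (β h)))

    toggled-cases : ∀ {P : V → Set} x → P h → P (β h) → P (β (β h)) →
                    (x ≢ h → x ≢ β h → x ≢ β (β h) → P x) → P x
    toggled-cases x p₁ p₂ p₃ p with x ≟ h
    ... | yes refl = p₁
    ... | no e₁ with x ≟ β h
    ... | yes refl = p₂
    ... | no e₂ with x ≟ β (β h)
    ... | yes refl = p₃
    ... | no e₃ = p e₁ e₂ e₃

  B≢A : ∀ x → B x ≢ A x
  B≢A x e = β-free x (trans (cong A e) (A² x))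

  private
    -- Every triangle is wholly on or wholly off, so a list that meets a triangle in several darts
    -- toggles it only once.
    record Swept (L : List V) : Set where
      field
        f           : V → V
        f-injective : Injective f
        on-or-off   : ∀ x → f x ≡ A x ⊎ f x ≡ B x
        on-β        : ∀ x → f x ≡ A x → f (β x) ≡ A (β x)
        on          : ∀ {x} → x ∈ L → f x ≡ A x
        same-parity : parity (# Orbit.orbits f f-injective) ≡ parity (# ⟨B⟩.orbits)

      off-β : ∀ x → f x ≡ B x → f (β x) ≡ B (β x)
      off-β x off with on-or-off (β x)
      ... | inj₂ e = e
      ... | inj₁ e = contradiction (trans (sym off)
        (subst (λ y → f y ≡ A y) (β³ x) (on-β (β (β x)) (on-β (β x) e)))) (B≢A x)

    sweep : ∀ L → Swept L
    sweep [] = record { f = B ; f-injective = B-injective ; on-or-off = λ _ → inj₂ refl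
                      ; on-β = λ x e → contradiction e (B≢A x) ; on = λ () ; same-parity = refl }
    sweep (h ∷ L) with sweep L
    ... | S with Swept.on-or-off S h
    ... | inj₁ e = record { f = f ; f-injective = f-injective ; on-or-off = on-or-off ; on-β = on-β
                          ; on = λ { (here refl) → e ; (there x∈L) → on x∈L } ; same-parity = same-parity }
      where open Swept S
    ... | inj₂ off = record
      { f = toggled ; f-injective = toggled-injective
      ; on-or-off = λ x → toggled-cases {λ x → toggled x ≡ A x ⊎ toggled x ≡ B x} x
          (inj₁ on-h) (inj₁ on-βh) (inj₁ on-ββh)
          λ e₁ e₂ e₃ → subst (λ y → y ≡ A x ⊎ y ≡ B x) (sym (toggled-fix e₁ e₂ e₃)) (on-or-off x)
      ; on-β = λ x → toggled-cases {λ x → toggled x ≡ A x → toggled (β x) ≡ A (β x)} x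
          (λ _ → on-βh) (λ _ → on-ββh) (λ _ → subst (λ y → toggled y ≡ A y) (sym (β³ h)) on-h)
          λ e₁ e₂ e₃ e → let βe : ∀ {y} → β x ≡ β y → x ≡ y
                             βe q = trans (sym (β³ x)) (trans (cong (β ∘ β) q) (β³ _))
                         in trans (toggled-fix (λ q → e₃ (βe (trans q (sym (β³ h))))) (e₁ ∘ βe) (e₂ ∘ βe))
                                  (on-β x (trans (sym (toggled-fix e₁ e₂ e₃)) e))
      ; on = λ { (here refl) → on-h
               ; {x} (there x∈L) → trans (toggled-fix (λ { refl → stays-on x∈L off })
                   (λ { refl → stays-on x∈L offβ }) (λ { refl → stays-on x∈L offββ })) (on x∈L) }
      ; same-parity = trans (sym (trans
          (transposition-parity f f-injective (β-free h ∘ sym))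
          (trans (cong _⁻¹ (transposition-parity T₁.f′ T₁.f′-injective (ββ-free h ∘ sym))) (ℙ.⁻¹-involutive _)))) same-parity
      }
      where
      open Swept S
      open Toggle f f-injective h
      offβ = off-β h off
      offββ = off-β (β h) offβ
      on-h = on₁ off offβ offββ
      on-βh = on₂ off offβ offββ
      on-ββh = on₃ off offβ offββ
      stays-on : ∀ {x} → x ∈ L → f x ≢ B x
      stays-on x∈L e = B≢A _ (trans (sym e) (on x∈L))

  A-injective : Injective A
  A-injective {x} {y} e = trans (sym (A² x)) (trans (cong A e) (A² y))

  -- Toggling all triangles turns B into A, and each toggle is a product of two transpositions.
  c-parity : parity (c []) ≡ parity (# Orbit.orbits A A-injective)
  c-parity = trans (cong parity (c-≡ [])) (trans (sym same-parity)
    (cong parity (orbits-cong f-injective A-injective (λ x → on (∈-allFin x)))))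
    where open Swept (sweep (allFin n))

  -- Boundary walks of forests

  boundary : List V → ∃ Injective
  boundary []      = B , B-injective
  boundary (h ∷ F) = let f , i = boundary F in Toggle.toggled f i h , Toggle.toggled-injective f i h

  Joined-β : ∀ X h → Joined X h → Joined X (β h)
  Joined-β X h (e , f) = f , subst (X ⊢ β (β h) ≈_) (sym (β³ h)) (⊢-sym X (⊢-trans X e f))

  record Boundary (X : Edges) (f : V → V) (f-injective : Injective f) : Set where
    open Orbit f f-injective using (_~_; ~-least)
    field
      follows : ∀ x → f x ≡ B x ⊎ (f x ≡ A x × Joined X x)
      covers  : ∀ {x y} → X ⊢ x ≈ y → x ~ y

    step : ∀ x → X ⊢ x ≈ f x
    step x with follows x
    ... | inj₁ e = subst (X ⊢ x ≈_) (sym e) (⊢-B X x)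
    ... | inj₂ (e , j₁ , j₂) = subst (X ⊢ x ≈_) (sym (trans e (A≡Bββ x)))
      (⊢-trans X (⊢-trans X j₁ j₂) (⊢-B X (β (β x))))

    within : ∀ {x y} → x ~ y → X ⊢ x ≈ y
    within = ~-least (⊢-isEquivalence X) step

  -- A new triangle of a forest has its darts in three different classes, hence in three orbits of
  -- the previous walk; so both transpositions of its toggle merge, and orbits keep matching
  -- classes.
  forest-boundary : ∀ F → Forest [] F → Boundary (F ▹ []) (proj₁ (boundary F)) (proj₂ (boundary F))
  forest-boundary []      _  = record { follows = λ _ → inj₁ refl ; covers = id }
  forest-boundary (h ∷ F) fF with forest-∷⁻ {[]} {F} fF
  ... | fF′ , s₁ , s₂ , s₃ = record { follows = fol ; covers = cov }
    where
    X X⁺ : Edges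
    X  = F ▹ []
    X⁺ = (h ∷ F) ▹ []
    open Boundary (forest-boundary F fF′)
    open Toggle (proj₁ (boundary F)) (proj₂ (boundary F)) h
    module O  = Orbit (proj₁ (boundary F)) (proj₂ (boundary F))
    module O₁ = Orbit T₁.f′ T₁.f′-injective
    module O₂ = Orbit toggled toggled-injective
    off : ∀ {x} → ¬ Joined X x → proj₁ (boundary F) x ≡ B x
    off {x} ¬j with follows x
    ... | inj₁ e = e
    ... | inj₂ (_ , j) = contradiction j ¬j
    off₁ = off {h} (s₁ ∘ proj₁)
    off₂ = off {β h} (s₂ ∘ proj₁)
    off₃ = off {β (β h)} (λ j → s₃ (⊢-sym X (subst (X ⊢ β (β h) ≈_) (β³ h) (proj₁ j))))
    X⊑X⁺ : X ⊑ X⁺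
    X⊑X⁺ = ▹-⊒ (h ∷ []) X
    jh : Joined X⁺ h
    jh = ▹-joined {h ∷ F} [] (here refl)
    fol : ∀ x → toggled x ≡ B x ⊎ (toggled x ≡ A x × Joined X⁺ x)
    fol x = toggled-cases {λ x → toggled x ≡ B x ⊎ (toggled x ≡ A x × Joined X⁺ x)} x
      (inj₂ (on₁ off₁ off₂ off₃ , jh))
      (inj₂ (on₂ off₁ off₂ off₃ , Joined-β X⁺ h jh))
      (inj₂ (on₃ off₁ off₂ off₃ , Joined-β X⁺ (β h) (Joined-β X⁺ h jh)))
      λ e₁ e₂ e₃ → subst (λ y → y ≡ B x ⊎ (y ≡ A x × Joined X⁺ x)) (sym (toggled-fix e₁ e₂ e₃))
        ([ inj₁ , (λ { (e , j) → inj₂ (e , Joined-mono X⊑X⁺ j) }) ]′ (follows x))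
    h≁βh : ¬ h O.~ β h
    h≁βh = s₁ ∘ within
    X₁ : Edges
    X₁ = (h , β h) ∷ X
    h≁ββh : ¬ h O₁.~ β (β h)
    h≁ββh e with O₁.~-least (⊢-isEquivalence X₁) (T₁.f′-step (⊢-isEquivalence X₁) (λ x → inj₁ (step x)) (⊢-head X)) e
    ... | inj₁ p = s₃ p
    ... | inj₂ (inj₁ (_ , p)) = s₂ p
    ... | inj₂ (inj₂ (p , _)) = s₁ p
    h~βh : h O₂.~ β h
    h~βh = T₂.preserves h≁ββh (T₁.merges h≁βh)
    cov : ∀ {x y} → X⁺ ⊢ x ≈ y → x O₂.~ y
    cov = span-least X⁺ O₂.~-isEquivalence (λ e → up (⊢-base X e))
      (h~βh ∷ O₂.~-trans (O₂.~-sym h~βh) (T₂.merges h≁ββh) ∷ All.map up (edges-joined (⊑-refl X)))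
      where
      up : ∀ {x y} → X ⊢ x ≈ y → x O₂.~ y
      up e = T₂.preserves h≁ββh (T₁.preserves h≁βh (covers e))

  boundary-head : ∀ h F → Forest [] (h ∷ F) → proj₁ (boundary (h ∷ F)) h ≡ A h
  boundary-head h F fF with forest-∷⁻ {[]} {F} fF
  ... | fF′ , s₁ , s₂ , s₃ = trans toggled-h (trans off (sym (A≡Bββ h)))
    where
    open Toggle (proj₁ (boundary F)) (proj₂ (boundary F)) h
    off : proj₁ (boundary F) (β (β h)) ≡ B (β (β h))
    off with Boundary.follows (forest-boundary F fF′) (β (β h))
    ... | inj₁ e = e
    ... | inj₂ (_ , j , _) = contradiction (⊢-sym (F ▹ []) (subst (F ▹ [] ⊢ β (β h) ≈_) (β³ h) j)) s₃

  -- Forests around two adjacent triangles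

  -- The neighbours, in cyclic order, of the vertex on which x lies.
  q : V → ℕ → V
  q x i = A (fold x B i)

  -- The four vertices of the adjacent triangles x and B x.
  D : V → Edges
  D x = (x , q x 0) ∷ (x , q x 1) ∷ (x , q x 2) ∷ []

  ββ≈q₀ : ∀ X x → X ⊢ β (β x) ≈ q x 0
  ββ≈q₀ X x = subst (X ⊢ β (β x) ≈_) (sym (A≡Bββ x)) (⊢-B X (β (β x)))

  fan-joined : ∀ X y → X ⊢ y ≈ q y 0 → X ⊢ y ≈ q y 1 → Joined X y
  fan-joined X y e₀ e₁ = e₁ , ⊢-trans X (⊢-sym X e₁) (⊢-trans X e₀ (⊢-sym X (ββ≈q₀ X y)))

  joined-fan : ∀ X y → Joined X y → X ⊢ y ≈ q y 0 × X ⊢ y ≈ q y 1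
  joined-fan X y (e , f) = ⊢-trans X (⊢-trans X e f) (ββ≈q₀ X y) , e

  module _ (X : Edges) (x : V) (D⊑X : D x ⊑ X) where

    private
      at : ∀ {p q} → (p , q) ∈ D x → X ⊢ p ≈ q
      at e = All.lookup (edges-joined D⊑X) e

    D-joined : Joined X x
    D-joined = fan-joined X x (at (here refl)) (at (there (here refl)))

    D-joined-B : Joined X (B x)
    D-joined-B = fan-joined X (B x)
      (⊢-trans X (⊢-sym X (⊢-B X x)) (at (there (here refl))))
      (⊢-trans X (⊢-sym X (⊢-B X x)) (at (there (there (here refl)))))

  translate-q : ∀ (t : Automorphism A B) x j → let open Automorphism t in θ (q x j) ≡ q (θ x) j
  translate-q t x j = trans (θ-A _) (cong A (θ-fold j x))
    where open Automorphism t

  q-B : ∀ x j → q (B x) j ≡ q x (suc j)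
  q-B x j = cong A (fold-shift B j x)

  [0,1]-suffice : ∀ X x → X ⊢ x ≈ q x 0 → X ⊢ x ≈ q x 1 →
    (∀ k → X ⊢ q x (2 + k) ≈ x ⊎ X ⊢ q x (2 + k) ≈ q x (1 + k) ⊎ X ⊢ q x (2 + k) ≈ q x k) →
    ∀ k → X ⊢ x ≈ q x k
  [0,1]-suffice X x e₀ e₁ rule k = proj₁ (go k)
    where
    go : ∀ k → X ⊢ x ≈ q x k × X ⊢ x ≈ q x (suc k)
    go zero    = e₀ , e₁
    go (suc k) with go k | rule k
    ... | _ , e | inj₁ f = e , ⊢-sym X f
    ... | _ , e | inj₂ (inj₁ f) = e , ⊢-trans X e (⊢-sym X f)
    ... | d , e | inj₂ (inj₂ f) = e , ⊢-trans X d (⊢-sym X f)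

  -- By transitivity, a coincidence of q x 2 with a corner of the triangle x repeats all around x.
  degenerate : ∀ X x → (x ∷ []) ▹ [] ⊢ x ≈ q x 2 → (x ∷ []) ▹ [] ⊑ X → ∀ k → X ⊢ x ≈ q x k
  degenerate X x e t⊑X = [0,1]-suffice X x (proj₁ fan) (proj₂ fan) λ k →
    let t , tx = translate x (fold x B k)
        open Automorphism t using (θ)
        q₂ : θ (q x 2) ≡ q x (2 + k)
        q₂ = trans (translate-q t x 2) (cong (λ y → q y 2) tx)
        tr : ∀ {z} → [] ⊢ q x 2 ≈ z → X ⊢ q x (2 + k) ≈ θ z
        tr {z} f = subst (X ⊢_≈ θ z) q₂ (⊢-base X (translate-⊢ t [] f))
    in [ (λ f → inj₁ (⊢-trans X (subst (X ⊢ q x (2 + k) ≈_) tx (tr f)) (⊢-sym X (⊢-fold X x k))))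
       , [ (λ f → inj₂ (inj₁ (subst (X ⊢ q x (2 + k) ≈_) (trans (translate-q t x 1) (cong (λ y → q y 1) tx)) (tr f))))
         , (λ f → inj₂ (inj₂ (subst (X ⊢ q x (2 + k) ≈_) (trans (translate-q t x 0) (cong (λ y → q y 0) tx))
                        (tr (⊢-trans [] f (ββ≈q₀ [] x)))))) ]′ ]′ (cases e)
    where
    fan = joined-fan X x (Joined-mono t⊑X (▹-joined {x ∷ []} [] (here refl)))
    sy : ∀ {y z} → [] ⊢ y ≈ z → [] ⊢ z ≈ y
    sy = ⊢-sym []
    inner : ∀ {y z} → (β x , β (β x)) ∷ [] ⊢ y ≈ z →
            [] ⊢ z ≈ y ⊎ [] ⊢ z ≈ β (β x) ⊎ [] ⊢ z ≈ β x
    inner (inj₁ f) = inj₁ (sy f)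
    inner (inj₂ (inj₁ (_ , f))) = inj₂ (inj₁ (sy f))
    inner (inj₂ (inj₂ (_ , f))) = inj₂ (inj₂ (sy f))
    cases : (x ∷ []) ▹ [] ⊢ x ≈ q x 2 → [] ⊢ q x 2 ≈ x ⊎ [] ⊢ q x 2 ≈ q x 1 ⊎ [] ⊢ q x 2 ≈ β (β x)
    cases (inj₁ f) with inner f
    ... | inj₁ g = inj₁ g
    ... | inj₂ (inj₁ g) = inj₂ (inj₂ g)
    ... | inj₂ (inj₂ g) = inj₂ (inj₁ g)
    cases (inj₂ (inj₁ (_ , f))) with inner f
    ... | inj₁ g = inj₂ (inj₁ g)
    ... | inj₂ (inj₁ g) = inj₂ (inj₂ g)
    ... | inj₂ (inj₂ g) = inj₂ (inj₁ g)
    cases (inj₂ (inj₂ (_ , f))) with inner f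
    ... | inj₁ g = inj₁ g
    ... | inj₂ (inj₁ g) = inj₂ (inj₂ g)
    ... | inj₂ (inj₂ g) = inj₂ (inj₁ g)

  classify : ∀ {P : V → Set} → (∀ x → Dec (P x)) → ∀ F → ∃₂ λ M K →
    length M + length K ≡ length F × (∀ {h} → h ∈ F → h ∈ M ⊎ h ∈ K) ×
    (∀ {h} → h ∈ M → h ∈ F × P h) × (∀ {h} → h ∈ K → h ∈ F × ¬ P h)
  classify P? [] = [] , [] , refl , (λ ()) , (λ ()) , λ ()
  classify P? (x ∷ F) with P? x | classify P? F
  ... | yes p | M , K , l , i , m , k = x ∷ M , K , cong suc l
    , (λ { (here e) → inj₁ (here e) ; (there h∈F) → [ inj₁ ∘ there , inj₂ ]′ (i h∈F) })
    , (λ { (here refl) → here refl , p ; (there h∈M) → there (proj₁ (m h∈M)) , proj₂ (m h∈M) })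
    , λ h∈K → there (proj₁ (k h∈K)) , proj₂ (k h∈K)
  ... | no ¬p | M , K , l , i , m , k = M , x ∷ K , trans (ℕ.+-suc _ _) (cong suc l)
    , (λ { (here e) → inj₂ (here e) ; (there h∈F) → [ inj₁ , inj₂ ∘ there ]′ (i h∈F) })
    , (λ h∈M → there (proj₁ (m h∈M)) , proj₂ (m h∈M))
    , λ { (here refl) → here refl , ¬p ; (there h∈K) → there (proj₁ (k h∈K)) , proj₂ (k h∈K) }

  -- Maximum forests leaving two classes

  module TwoClasses {ν : ℕ} (maximum : Maximum ν) (c≡ : c [] ≡ ν * 2 + 2) where
    open MaximumForests maximum 2 c≡
    open Optimal

    -- A forest containing the triangle x joins x to `q x 0` and `q x 1`, so j is at least 2 here;
    -- the descent to a diamond lowers j.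
    Sep : V → ℕ → Set
    Sep x j = ∃ λ F → Optimal (x ∷ F) × ¬ (x ∷ F) ▹ [] ⊢ x ≈ q x j

    translate-sep : ∀ {x j} → Sep x j → ∀ y → Sep y j
    translate-sep {x} {j} (F , o , x≉) y with translate x y
    ... | t , refl = map θ F , translate-optimal t o
                   , x≉ ∘ translate-⊢⁻ t (x ∷ F) ∘ subst (map θ (x ∷ F) ▹ [] ⊢ θ x ≈_) (sym (translate-q t x j))
      where open Automorphism t

    -- F has ν - 1 triangles. With the three edges of `D x` they merge at most 2ν + 1 times, just
    -- enough to reduce the 2ν + 2 initial classes to one.
    Diamond : V → Set
    Diamond x = ∃ λ F → 2 + length F ≡ suc ν × c (F ▹ D x) ≤ 1

    augmented : ∀ x G h → 2 + length G ≡ ν → c (G ▹ D x) ≤ 3 → Split (G ▹ D x) h → Diamond x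
    augmented x G h |G| cG s = h ∷ G , cong suc |G| ,
      s≤s⁻¹ (s≤s⁻¹ (ℕ.≤-trans (ℕ.≤-reflexive (sym (split⇒ (G ▹ D x) s))) cG))

    -- The ν - 2 triangles and three edges merge at most 2ν - 1 times, starting from 2ν + 2 classes.
    3≤c-D : ∀ x G → 2 + length G ≡ ν → 3 ≤ c (G ▹ D x)
    3≤c-D x G |G| = ℕ.+-cancelˡ-≤ (3 + length G * 2) _ _ (ℕ.≤-trans (ℕ.≤-reflexive shuffle) (ℕ.≤-trans (ℕ.≤-reflexive (sym c≡))
      (ℕ.≤-trans (c-∷ [] x (q x 2)) (s≤s (ℕ.≤-trans (c-∷ _ x (q x 1)) (s≤s (ℕ.≤-trans (c-∷ _ x (q x 0)) (s≤s (c-▹ G (D x))))))))))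
      where
      shuffle : (3 + length G * 2) + 3 ≡ ν * 2 + 2
      shuffle = trans (cong (3 +_) (ℕ.+-comm (length G * 2) 3))
        (trans (sym (cong (4 +_) (ℕ.+-comm (length G * 2) 2))) (cong (λ l → l * 2 + 2) |G|))

    -- Sacrificing a triangle of a forest through the triangle x makes room for the diamond D x.
    near-diamond : ∀ {x j F} → Optimal (x ∷ F) → ¬ (x ∷ F) ▹ [] ⊢ x ≈ q x j → (x ∷ F) ▹ [] ⊢ x ≈ q x 2 →
                   ∃ λ G → 2 + length G ≡ ν × c (G ▹ D x) ≤ 3 × ¬ G ▹ D x ⊢ x ≈ q x j
    near-diamond {x} {j} {F} o x≉ e
      -- ρ is a triangle whose addition joins x to `q x 2`; the triangle x alone does not, by
      -- `degenerate`.
      with last-suffix (λ M → ¬? (⊢? (M ▹ (x ∷ []) ▹ []) x (q x 2))) F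
             (λ f → x≉ (degenerate ((x ∷ F) ▹ []) x f (▹-mono {x ∷ []} {x ∷ F} (λ { (here r) → here r }) ⊑-[]) j))
             (λ ¬e → ¬e (⊑⇒⊆ (push F x []) e))
    ... | F₁ , ρ , F₂ , refl , ¬eS , ¬¬eS = F₁ ++ F₂ , size′ , bound′ , x≉ ∘ ⊑⇒⊆ new⊑old
      where
      S GD : Edges
      S  = F₂ ▹ (x ∷ []) ▹ []
      GD = (F₁ ++ F₂) ▹ D x
      eS : (ρ ∷ F₂) ▹ (x ∷ []) ▹ [] ⊢ x ≈ q x 2
      eS = decidable-stable (⊢? ((ρ ∷ F₂) ▹ (x ∷ []) ▹ []) x (q x 2)) ¬¬eS
      size′ : 2 + length (F₁ ++ F₂) ≡ ν
      size′ = trans (cong suc (trans (cong suc (length-++ F₁)) (trans (sym (ℕ.+-suc _ _)) (sym (length-++ F₁))))) (size o)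
      fan = joined-fan ((x ∷ F₁ ++ ρ ∷ F₂) ▹ []) x (▹-joined {x ∷ F₁ ++ ρ ∷ F₂} [] (here refl))
      new⊑old : GD ⊑ (x ∷ F₁ ++ ρ ∷ F₂) ▹ []
      new⊑old = ▹-⊑ {F₁ ++ F₂} (λ h∈ → ▹-joined {x ∷ F₁ ++ ρ ∷ F₂} [] (there (widen h∈)))
        (⊑-∷ˡ (proj₁ fan) (⊑-∷ˡ (proj₂ fan) (⊑-∷ˡ e ⊑-[])))
        where
        widen : ∀ {h} → h ∈ F₁ ++ F₂ → h ∈ F₁ ++ ρ ∷ F₂
        widen h∈ with ∈-++⁻ F₁ h∈
        ... | inj₁ p = ∈-++⁺ˡ p
        ... | inj₂ p = ∈-++⁺ʳ F₁ (there p)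
      old⊑ρ+new : (x ∷ F₁ ++ ρ ∷ F₂) ▹ [] ⊑ (ρ ∷ []) ▹ GD
      old⊑ρ+new = ▹-⊑ {x ∷ F₁ ++ ρ ∷ F₂}
        (λ { (here refl) → Joined-mono (▹-⊒ (ρ ∷ []) GD) (D-joined GD x (▹-⊒ (F₁ ++ F₂) (D x)))
           ; (there h∈) → narrow h∈ }) ⊑-[]
        where
        narrow : ∀ {h} → h ∈ F₁ ++ ρ ∷ F₂ → Joined ((ρ ∷ []) ▹ GD) h
        narrow h∈ with ∈-++⁻ F₁ h∈
        ... | inj₁ p = Joined-mono (▹-⊒ (ρ ∷ []) GD) (▹-joined {F₁ ++ F₂} (D x) (∈-++⁺ˡ p))
        ... | inj₂ (here refl) = ▹-joined {ρ ∷ []} GD (here refl)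
        ... | inj₂ (there p) = Joined-mono (▹-⊒ (ρ ∷ []) GD) (▹-joined {F₁ ++ F₂} (D x) (∈-++⁺ʳ F₁ p))
      S⊑GD : (x , q x 2) ∷ S ⊑ GD
      S⊑GD = ⊑-∷ˡ (All.lookup (edges-joined (▹-⊒ (F₁ ++ F₂) (D x))) (there (there (here refl))))
        (▹-⊑ {F₂} (λ h∈ → ▹-joined {F₁ ++ F₂} (D x) (∈-++⁺ʳ F₁ h∈))
          (▹-⊑ {x ∷ []} (λ { (here refl) → D-joined GD x (▹-⊒ (F₁ ++ F₂) (D x)) }) ⊑-[]))
      -- Over S the triangle ρ already implies the edge, so the two merge at most twice together,
      -- and the edge accounts for one of these merges.
      ¬s : ¬ Split ((x , q x 2) ∷ S) ρ
      ¬s s = ℕ.1+n≰n (ℕ.≤-trans (ℕ.≤-reflexive (sym (trans (c-∉ S ¬eS) (cong suc (split⇒ ((x , q x 2) ∷ S) s)))))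
        (ℕ.≤-trans (c-▹₁ S ρ) (s≤s (s≤s (c-antimono
          (⊑-trans (▹-∷-comm (ρ ∷ []) (x , q x 2) S) (⊑-∷ˡ eS (⊑-refl _))))))))
      bound′ : c GD ≤ 3
      bound′ = ℕ.≤-trans (¬split⇒ GD (λ s → ¬s (Split-antimono S⊑GD s)))
        (s≤s (ℕ.≤-trans (c-antimono old⊑ρ+new) (bound o)))

    -- The triangle `fold x B j` has its corners at x, `q x (suc j)` and `q x j`. If joining x to
    -- `q x j` also joined it to `q x (suc j)`, the result, with at least two classes, would contain
    -- the forest through `B x` and the edge separated by it, which leave only one. So this triangle
    -- is split and completes the diamond.
    absorbed-diamond : ∀ {x j T} → Optimal (B x ∷ T) → ¬ (B x ∷ T) ▹ [] ⊢ B x ≈ q (B x) j →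
      ∀ G → 2 + length G ≡ ν → c (G ▹ D x) ≤ 3 → ¬ G ▹ D x ⊢ x ≈ q x j →
      (∀ {h} → h ∈ T → Joined ((x , q x j) ∷ G ▹ D x) h) → Diamond x
    absorbed-diamond {x} {j} {T} oT Bx≉ G |G| cG x≉G T⊆ = augmented x G y |G| cG
      ( (λ f → x≉q′ (inj₁ (⊢-trans Z (⊢-fold Z x j) f)))
      , (λ f → x≉q′ (⊢-trans Z′ (⊢-head Z) (inj₁ (⊢-sym Z (⊢-trans Z f (ββ≈q₀ Z y))))))
      , (λ f → x≉G (⊢-trans Z (⊢-fold Z x j) (⊢-trans Z f (ββ≈q₀ Z y)))) )
      where
      y : V
      y = fold x B j
      Z Z′ : Edges
      Z  = G ▹ D x
      Z′ = (x , q x j) ∷ Z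
      TB⊑Z′ : (B x ∷ T) ▹ [] ⊑ Z′
      TB⊑Z′ = ▹-⊑ {B x ∷ T} (λ { (here refl) → D-joined-B Z′ x (⊑-∷ʳ _ (▹-⊒ G (D x)))
                               ; (there h∈T) → T⊆ h∈T }) ⊑-[]
      x≉q′ : ¬ Z′ ⊢ x ≈ q x (suc j)
      x≉q′ f = ℕ.1+n≰n (ℕ.≤-trans (3≤c-D x G |G|) (ℕ.≤-trans (ℕ.≤-reflexive (c-∉ Z x≉G))
        (ℕ.≤-trans (s≤s (c-antimono (⊑-∷ˡ g TB⊑Z′)))
        (ℕ.≤-trans (ℕ.≤-reflexive (sym (c-∉ ((B x ∷ T) ▹ []) Bx≉))) (bound oT)))))
        where
        g : Z′ ⊢ B x ≈ q (B x) j
        g = subst (Z′ ⊢ B x ≈_) (sym (q-B x j)) (⊢-trans Z′ (⊢-sym Z′ (⊢-B Z′ x)) f)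

    D⊑ : ∀ X x → X ⊢ x ≈ q x 0 → Joined X (B x) → D x ⊑ X
    D⊑ X x e₀ jB = let e₁ , e₂ = joined-fan X (B x) jB in
      ⊑-∷ˡ e₀ (⊑-∷ˡ (⊢-trans X (⊢-B X x) e₁) (⊑-∷ˡ (⊢-trans X (⊢-B X x) e₂) ⊑-[]))

    -- h is split over `B x` and K, but not over K and `D x`, which add at most the edge from x to
    -- `q x 0`. So h itself closes that edge, and `B x`, h, G together imply all of `D x`.
    blocked-optimal : ∀ {x p T} → Optimal (B x ∷ T) → ∀ G K h →
      2 + length G ≡ ν → c (G ▹ D x) ≤ 3 → ¬ G ▹ D x ⊢ x ≈ p → (∀ {k} → k ∈ K → k ∈ G × k ∈ T) → h ∈ T →
      ¬ Joined ((x , p) ∷ G ▹ D x) h → ¬ Split (G ▹ D x) h → ¬ Split (K ▹ D x) h →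
      Optimal (B x ∷ h ∷ G) × ¬ (B x ∷ h ∷ G) ▹ [] ⊢ x ≈ p
    blocked-optimal {x} {p} {T} oT G K h |G| cG x≉G K⊆ h∈T ¬j ¬s ¬sK =
      optimal |G| cW , λ f → stays-separated (G ▹ D x) x≉G ¬j ¬s (⊑⇒⊆ W⊑ f)
      where
      S W : Edges
      S = (B x ∷ K) ▹ []
      W = (B x ∷ h ∷ G) ▹ []
      h∉ : h ∉ B x ∷ K
      h∉ (here refl) = ¬j (D-joined-B ((x , p) ∷ G ▹ D x) x (⊑-∷ʳ _ (▹-⊒ G (D x))))
      h∉ (there h∈K) = ¬j (Joined-mono (⊑-∷ʳ (x , p) (⊑-refl (G ▹ D x))) (▹-joined {G} (D x) (proj₁ (K⊆ h∈K))))
      sS : Split S h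
      sS = forest-split {[]} {B x ∷ T} {B x ∷ K} (forest oT) (there h∈T)
             (λ { (here r) → here r ; (there k∈K) → there (proj₂ (K⊆ k∈K)) }) h∉
      KD⊑ : K ▹ D x ⊑ (x , q x 0) ∷ S
      KD⊑ = ▹-⊑ {K} (λ k∈K → Joined-mono (⊑-∷ʳ (x , q x 0) (⊑-refl S)) (▹-joined {B x ∷ K} [] (there k∈K)))
        (D⊑ ((x , q x 0) ∷ S) x (⊢-head S)
            (Joined-mono (⊑-∷ʳ (x , q x 0) (⊑-refl S)) (▹-joined {B x ∷ K} [] (here refl))))
      e₀ : (h ∷ []) ▹ S ⊢ x ≈ q x 0
      e₀ = closing-edge S sS (λ s → ¬sK (Split-antimono KD⊑ s))
      in-W : ∀ {k} → k ∈ B x ∷ h ∷ G → Joined W k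
      in-W = ▹-joined {B x ∷ h ∷ G} []
      hS⊑W : (h ∷ []) ▹ S ⊑ W
      hS⊑W = ▹-⊑ {h ∷ []} {S} {W} (λ { (here refl) → in-W (there (here refl)) })
        (▹-⊑ {B x ∷ K} {[]} {W} (λ { (here refl) → in-W (here refl)
                                   ; (there k∈K) → in-W (there (there (proj₁ (K⊆ k∈K)))) }) ⊑-[])
      ⊑W : (h ∷ G) ▹ D x ⊑ W
      ⊑W = ▹-⊑ {h ∷ G} {D x} {W} (λ h∈ → in-W (there h∈)) (D⊑ W x (⊑⇒⊆ hS⊑W e₀) (in-W (here refl)))
      W⊑ : W ⊑ (h ∷ G) ▹ D x
      W⊑ = ▹-⊑ {B x ∷ h ∷ G} (λ { (here refl) → D-joined-B ((h ∷ G) ▹ D x) x (▹-⊒ (h ∷ G) (D x))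
                                ; (there h∈) → ▹-joined {h ∷ G} (D x) h∈ }) ⊑-[]
      cW : c W ≤ 2
      cW = ℕ.≤-trans (c-antimono ⊑W) (s≤s⁻¹ (ℕ.≤-trans (¬joined⇒ (G ▹ D x)
        (λ j′ → ¬j (Joined-mono (⊑-∷ʳ (x , p) (⊑-refl (G ▹ D x))) j′))) cG))

    separated-diamond : ∀ {x F} → Optimal (x ∷ F) → ¬ (x ∷ F) ▹ [] ⊢ x ≈ q x 2 → Diamond x
    separated-diamond {x} {F} o x≉q₂ = F , cong suc (size o) , s≤s⁻¹ (ℕ.≤-trans (s≤s (c-antimono old⊑))
          (ℕ.≤-trans (ℕ.≤-reflexive (sym (c-∉ ((x ∷ F) ▹ []) x≉q₂))) (bound o)))
      where
      old⊑ : (x , q x 2) ∷ (x ∷ F) ▹ [] ⊑ F ▹ D x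
      old⊑ = ⊑-∷ˡ (All.lookup (edges-joined (▹-⊒ F (D x))) (there (there (here refl))))
        (▹-⊑ {x ∷ F} (λ { (here refl) → D-joined (F ▹ D x) x (▹-⊒ F (D x))
                        ; (there h∈F) → ▹-joined {F} (D x) h∈F }) ⊑-[])

    -- Induction on j: exchange a near-diamond at x towards a forest through B x that separates
    -- q x (1 + j); being blocked lowers j.
    sep⇒diamond : ∀ j x → Sep x j → ∃ Diamond
    sep⇒diamond zero x (F , o , x≉) = contradiction
      (proj₁ (joined-fan ((x ∷ F) ▹ []) x (▹-joined {x ∷ F} [] (here refl)))) x≉
    sep⇒diamond (suc j) x sep@(F , o , x≉) with ⊢? ((x ∷ F) ▹ []) x (q x 2)
    ... | no x≉q₂ = x , separated-diamond o x≉q₂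
    ... | yes e = move (near-diamond {x} {suc j} {F} o x≉ e) (translate-sep {x} {suc j} sep (B x))
      where
      move : (∃ λ G → 2 + length G ≡ ν × c (G ▹ D x) ≤ 3 × ¬ G ▹ D x ⊢ x ≈ q x (suc j)) → Sep (B x) (suc j) → ∃ Diamond
      move (G₀ , |G₀| , cG₀ , x≉G₀) (T , oT , Bx≉) = finish
        (exchange {D x} {T} {x} {q x (suc j)} {length G₀} {3} (suc (length G₀)) G₀ [] ℕ.≤-refl (ℕ.+-identityʳ _) cG₀ x≉G₀ (λ ()))
        where
        finish : Outcome (D x) T x (q x (suc j)) (length G₀) 3 → ∃ Diamond
        finish (augment G h |G| cG s) = x , augmented x G h (trans (cong (2 +_) |G|) |G₀|) cG s
        finish (absorbed G |G| cG x≉G T⊆) =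
          x , absorbed-diamond {x} {suc j} {T} oT Bx≉ G (trans (cong (2 +_) |G|) |G₀|) cG x≉G T⊆
        finish (blocked G K h |G| cG x≉G K⊆ h∈T ¬j ¬s ¬sK) =
          let W = (B x ∷ h ∷ G) ▹ []
              oW , x≉W = blocked-optimal {x} {q x (suc j)} {T} oT G K h (trans (cong (2 +_) |G|) |G₀|) cG x≉G K⊆ h∈T ¬j ¬s ¬sK
          -- Counted from `B x`, the neighbour `q x (suc j)` has index j.
          in sep⇒diamond j (B x) (h ∷ G , oW , λ f → x≉W (⊢-trans W (⊢-B W x) (subst (W ⊢ B x ≈_) (q-B x j) f)))

    Touches : V → V → Set
    Touches x h = [] ⊢ x ≈ h ⊎ [] ⊢ x ≈ β h ⊎ [] ⊢ x ≈ β (β h)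

    Touches? : ∀ x h → Dec (Touches x h)
    Touches? x h = ⊢? [] _ _ ⊎-dec (⊢? [] _ _ ⊎-dec ⊢? [] _ _)

    -- Lying on the same s-gon as x is invariant along every side of a triangle that does not touch
    -- x.
    untouched-isolated : ∀ {x K} → (∀ {h} → h ∈ K → ¬ Touches x h) → ∀ {y} → K ▹ [] ⊢ x ≈ y → [] ⊢ x ≈ y
    untouched-isolated {x} {K} far e = proj₁ (span-least (K ▹ []) {S}
        (record { refl  = id , id
                ; sym   = λ { (f , g) → g , f }
                ; trans = λ { (f , g) (f′ , g′) → f′ ∘ f , g ∘ g′ } })
        (λ e → (λ f → ⊢-trans [] f e) , (λ f → ⊢-trans [] f (⊢-sym [] e)))
        (▹-all {K} {S = S} (λ h∈K → let ¬t = far h∈K in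
            ((λ f → contradiction (inj₁ f) ¬t) , (λ f → contradiction (inj₂ (inj₁ f)) ¬t))
          , ((λ f → contradiction (inj₂ (inj₁ f)) ¬t) , (λ f → contradiction (inj₂ (inj₂ f)) ¬t))) [])
        e) (⊢-refl [])
      where
      S : V → V → Set
      S u v = ([] ⊢ x ≈ u → [] ⊢ x ≈ v) × ([] ⊢ x ≈ v → [] ⊢ x ≈ u)

    -- Rotated so that its first corner is x, the triangle m has two consecutive neighbours of x as
    -- its other corners.
    unjoined-at : ∀ J {x m} → ¬ Joined J m → Touches x m → ∃ λ k → ¬ J ⊢ x ≈ q x k
    unjoined-at J {x} ¬j (inj₁ (k , refl)) with ⊢? J x (q x k) | ⊢? J x (q x (suc k))
    ... | no e | _ = k , e
    ... | yes _ | no f = suc k , f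
    ... | yes e | yes f = contradiction (fan-joined J (fold x B k)
      (⊢-trans J (⊢-sym J (⊢-fold J x k)) e) (⊢-trans J (⊢-sym J (⊢-fold J x k)) f)) ¬j
    unjoined-at J {x} {m} ¬j (inj₂ (inj₁ e)) = unjoined-at J
      (λ j → ¬j (subst (Joined J) (β³ m) (Joined-β J (β (β m)) (Joined-β J (β m) j)))) (inj₁ e)
    unjoined-at J {x} {m} ¬j (inj₂ (inj₂ e)) = unjoined-at J
      (λ j → ¬j (subst (Joined J) (β³ m) (Joined-β J (β (β m)) j))) (inj₁ e)

    module _ {F} (o : Optimal F) {x} (conn : F ▹ [] ⊢ x ≈ β x) (sepd : ¬ F ▹ [] ⊢ x ≈ β (β x))
             (x≉βx : ¬ [] ⊢ x ≈ β x) where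

      private
        sorted = classify (Touches? x) F
        N = proj₁ sorted
        K = proj₁ (proj₂ sorted)
        |MK| : length N + length K ≡ length F
        |MK| = proj₁ (proj₂ (proj₂ sorted))
        F⊆MK : ∀ {h} → h ∈ F → h ∈ N ⊎ h ∈ K
        F⊆MK = proj₁ (proj₂ (proj₂ (proj₂ sorted)))
        N⊆ : ∀ {h} → h ∈ N → h ∈ F × Touches x h
        N⊆ = proj₁ (proj₂ (proj₂ (proj₂ (proj₂ sorted))))
        K⊆ : ∀ {h} → h ∈ K → h ∈ F × ¬ Touches x h
        K⊆ = proj₂ (proj₂ (proj₂ (proj₂ (proj₂ sorted))))

        F⊑MK : F ▹ [] ⊑ N ▹ K ▹ []
        F⊑MK = ▹-⊑ {F} (λ h∈F → [ ▹-joined {N} (K ▹ []) , (λ h∈K → Joined-mono (▹-⊒ N (K ▹ [])) (▹-joined {K} [] h∈K)) ]′ (F⊆MK h∈F)) ⊑-[]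

        MK⊑F : N ▹ K ▹ [] ⊑ F ▹ []
        MK⊑F = ▹-⊑ {N} (λ h∈N → ▹-joined {F} [] (proj₁ (N⊆ h∈N))) (▹-⊑ {K} (λ h∈K → ▹-joined {F} [] (proj₁ (K⊆ h∈K))) ⊑-[])

        βx≉ββx : ¬ F ▹ [] ⊢ β x ≈ β (β x)
        βx≉ββx e = sepd (⊢-trans (F ▹ []) conn e)

      -- Exchange x for a triangle of F that touches x and lies on the path from x to β x.
      exchange-at : ∃ (Sep x)
      exchange-at with last-suffix (λ L → ¬? (⊢? (L ▹ K ▹ []) x (β x))) N
                         (λ e → x≉βx (untouched-isolated (proj₂ ∘ K⊆) e)) (λ ¬e → ¬e (⊑⇒⊆ F⊑MK conn))
      ... | M₁ , m , M₂ , N≡ , ¬e , ¬¬e = proj₁ found , J , optimal |J| cJ , proj₂ found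
        where
        X mX J▹ : Edges
        X = M₂ ▹ K ▹ []
        mX = M₁ ▹ (m ∷ []) ▹ X
        J : List V
        J = M₁ ++ M₂ ++ K
        J▹ = (x ∷ J) ▹ []
        ∈N : ∀ {h} → h ∈ M₁ ++ m ∷ M₂ → h ∈ N
        ∈N {h} = subst (h ∈_) (sym N≡)
        |J| : length (x ∷ J) ≡ ν
        |J| = trans (cong suc (trans (length-++ M₁) (cong (length M₁ +_) (length-++ M₂))))
          (trans (cong suc (sym (ℕ.+-assoc (length M₁) (length M₂) (length K))))
          (trans (cong (_+ length K) (trans (sym (ℕ.+-suc _ _)) (trans (sym (length-++ M₁)) (cong length (sym N≡)))))
          (trans |MK| (size o))))
        MK≡ : N ▹ K ▹ [] ≡ mX
        MK≡ = trans (cong (_▹ K ▹ []) N≡) (++-▹ M₁ (m ∷ M₂))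
        mX⊑F : mX ⊑ F ▹ []
        mX⊑F = subst (_⊑ F ▹ []) MK≡ MK⊑F
        X⊑F : X ⊑ F ▹ []
        X⊑F = ⊑-trans (⊑-trans (▹-⊒ (m ∷ []) X) (▹-⊒ M₁ _)) mX⊑F
        xX⊑J : M₁ ▹ (x ∷ []) ▹ X ⊑ J▹
        xX⊑J = ▹-⊑ {M₁} (λ h∈ → ▹-joined {x ∷ J} [] (there (∈-++⁺ˡ h∈)))
          (▹-⊑ {x ∷ []} (λ { (here refl) → ▹-joined {x ∷ J} [] (here refl) })
          (▹-⊑ {M₂} (λ h∈ → ▹-joined {x ∷ J} [] (there (∈-++⁺ʳ M₁ (∈-++⁺ˡ h∈))))
          (▹-⊑ {K} (λ h∈ → ▹-joined {x ∷ J} [] (there (∈-++⁺ʳ M₁ (∈-++⁺ʳ M₂ h∈)))) ⊑-[])))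
        sX : Split X x
        sX = ¬e , (λ f → βx≉ββx (⊑⇒⊆ X⊑F f)) , (λ f → sepd (⊑⇒⊆ X⊑F f))
        cJ : c J▹ ≤ 2
        cJ = ℕ.≤-trans (c-antimono xX⊑J) (ℕ.≤-trans
          (exchange-≤ M₁ sX (λ s → ¬¬e (proj₁ s)) (λ j → βx≉ββx (⊑⇒⊆ mX⊑F (proj₂ j))))
          (ℕ.≤-trans (c-antimono (subst (F ▹ [] ⊑_) MK≡ F⊑MK)) (bound o)))
        -- Otherwise this maximum forest would join all of F and also the triangle x, which merges
        -- the two classes left by F.
        ¬joined : ¬ Joined J▹ m
        ¬joined j = ℕ.1+n≰n (ℕ.≤-trans (s≤s (ℕ.≤-trans (C≤c (optimal |J| cJ)) (c-antimono xF⊑J)))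
          (ℕ.≤-trans (¬joined⇒ (F ▹ []) (λ j′ → βx≉ββx (proj₂ j′))) (bound o)))
          where
          old : ∀ {h} → h ∈ M₁ ++ m ∷ M₂ → Joined J▹ h
          old h∈ with ∈-++⁻ M₁ h∈
          ... | inj₁ p = ▹-joined {x ∷ J} [] (there (∈-++⁺ˡ p))
          ... | inj₂ (here refl) = j
          ... | inj₂ (there p) = ▹-joined {x ∷ J} [] (there (∈-++⁺ʳ M₁ (∈-++⁺ˡ p)))
          xF⊑J : (x ∷ []) ▹ F ▹ [] ⊑ J▹
          xF⊑J = ▹-⊑ {x ∷ []} (λ { (here refl) → ▹-joined {x ∷ J} [] (here refl) })
            (▹-⊑ {F} (λ {h} h∈F → [ (λ h∈N → old (subst (h ∈_) N≡ h∈N))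
                                  , (λ h∈K → ▹-joined {x ∷ J} [] (there (∈-++⁺ʳ M₁ (∈-++⁺ʳ M₂ h∈K)))) ]′ (F⊆MK h∈F)) ⊑-[])
        found : ∃ λ k → ¬ J▹ ⊢ x ≈ q x k
        found = unjoined-at J▹ ¬joined (proj₂ (N⊆ (∈N (∈-++⁺ʳ M₁ (here refl)))))

    -- A triangle on a separated edge is not split, by maximality, so exactly two of its corners are
    -- joined; y is the rotation that lists them first.
    mixed-triangle : ∀ {F} → Optimal F → ∀ x → ¬ F ▹ [] ⊢ x ≈ A x → ∃ λ y → F ▹ [] ⊢ y ≈ β y × ¬ F ▹ [] ⊢ y ≈ β (β y)
    mixed-triangle {F} o x x≉Ax = exhaust
      where
      Y : Edges
      Y = F ▹ []
      g : V
      g = B⁻¹ x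
      βg : β g ≡ A x
      βg = cong A (BB⁻¹ x)
      g≉βg : ¬ Y ⊢ g ≈ β g
      g≉βg e = x≉Ax (subst₂ (Y ⊢_≈_) (BB⁻¹ x) βg (⊢-trans Y (⊢-sym Y (⊢-B Y g)) e))
      exhaust : ∃ λ y → Y ⊢ y ≈ β y × ¬ Y ⊢ y ≈ β (β y)
      exhaust with ⊢? Y (β g) (β (β g)) | ⊢? Y g (β (β g))
      ... | yes e | _ = β g , e , λ f → g≉βg (⊢-sym Y (subst (Y ⊢ β g ≈_) (β³ g) f))
      ... | no _ | yes f = β (β g) , subst (Y ⊢ β (β g) ≈_) (sym (β³ g)) (⊢-sym Y f)
                         , λ h → g≉βg (⊢-trans Y f (subst (Y ⊢ β (β g) ≈_) (cong β (β³ g)) h))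
      ... | no ¬e | no ¬f = contradiction (g≉βg , ¬e , ¬f) (unsplit o g)

    diamond : ∀ {F} → Optimal F → ∃ Diamond
    diamond {F} o =
      let x , x≉Ax = separated-edge (F ▹ []) (C≤c o)
          y , conn , sepd = mixed-triangle o x x≉Ax
          -- The edge from y to `β y` is separated by some maximum forest, hence is not a loop of
          -- the triangulation.
          G , _ , By≉ = translate-separable (F , o , x≉Ax) (B y)
          G′ = G ▹ []
          j , s = exchange-at o conn sepd (λ e → By≉ (⊢-trans G′ (⊢-sym G′ (⊢-B G′ y)) (⊢-base G′ e)))
      in sep⇒diamond j y s

-- From forests to closed walks

module Walks {n : ℕ} (M : RegularMap n) where
  open RegularMap M
  open Forests M

  private
    V = Fin n

  c-positive : ∀ X (x : V) → 1 ≤ c X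
  c-positive X x = ℕ.≤-trans (#-positive (span X) x) (ℕ.≤-reflexive (sym (c-≡ X)))

  c≤1⇒total : ∀ X → c X ≤ 1 → ∀ x y → X ⊢ x ≈ y
  c≤1⇒total X cX x y with ⊢? X x y
  ... | yes e = e
  ... | no ¬e = contradiction
    (ℕ.≤-trans (s≤s (c-positive ((x , y) ∷ X) x)) (ℕ.≤-trans (ℕ.≤-reflexive (sym (c-∉ X ¬e))) cX)) ℕ.1+n≰n

  record Hamiltonian : Set where
    field
      f           : V → V
      f-injective : Injective f
      total       : ∀ x y → Orbit._~_ f f-injective x y
      follows     : ∀ x → f x ≡ B x ⊎ f x ≡ A x

  one-class⇒hamiltonian : ∀ F → Forest [] F → c (F ▹ []) ≤ 1 → Hamiltonian
  one-class⇒hamiltonian F fF cF = record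
    { f = proj₁ (boundary F) ; f-injective = proj₂ (boundary F)
    ; total = λ x y → covers (c≤1⇒total (F ▹ []) cF x y)
    ; follows = λ x → [ inj₁ , inj₂ ∘ proj₁ ]′ (follows x) }
    where open Boundary (forest-boundary F fF)

  -- Read from A x on, f leaves the graph only at its last step, from β x; without the last two
  -- vertices B x and β x it closes up through the edge from x to A x.
  record NearlyHamiltonian : Set where
    field
      f           : V → V
      f-injective : Injective f
      total       : ∀ x y → Orbit._~_ f f-injective x y
      x           : V
      f-x         : f x ≡ B x
      f-Bx        : f (B x) ≡ β x
      f-βx        : f (β x) ≡ A x
      follows     : ∀ {y} → y ≢ β x → f y ≡ B y ⊎ f y ≡ A y

  module _ (x : V) (W : Edges) (π : V → V) (π-injective : Injective π) (bd : Boundary W π π-injective)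
           (jB : Joined W (B x)) (on-Bx : π (B x) ≡ A (B x)) (x≉q₀ : ¬ W ⊢ x ≈ q x 0)
           (total⁺ : ∀ y z → (x , q x 0) ∷ W ⊢ y ≈ z) where

    private
      module Bd = Boundary bd
      module T = Transposition π π-injective (β x) (β (β x))
      module O = Orbit T.f′ T.f′-injective
      x≉ββx : ¬ W ⊢ x ≈ β (β x)
      x≉ββx e = x≉q₀ (⊢-trans W e (ββ≈q₀ W x))
      x≈βx : W ⊢ x ≈ β x
      x≈βx = ⊢-trans W (⊢-B W x) (proj₁ (joined-fan W (B x) jB))
      ¬jββ : ¬ Joined W (β (β x))
      ¬jββ j = x≉ββx (⊢-sym W (subst (W ⊢ β (β x) ≈_) (β³ x) (proj₁ j)))
      off : ∀ {y} → ¬ Joined W y → π y ≡ B y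
      off {y} ¬j with Bd.follows y
      ... | inj₁ e = e
      ... | inj₂ (_ , j) = contradiction j ¬j
      βx≁ββx : ¬ Orbit._~_ π π-injective (β x) (β (β x))
      βx≁ββx e = x≉ββx (⊢-trans W x≈βx (Bd.within e))
      up : ∀ {y z} → W ⊢ y ≈ z → y O.~ z
      up e = T.preserves βx≁ββx (Bd.covers e)
      linked : ∀ {y z} → (x , q x 0) ∷ W ⊢ y ≈ z → y O.~ z
      linked = join-least (span W) O.~-isEquivalence up
        (O.~-trans (up x≈βx) (O.~-trans (T.merges βx≁ββx) (up (ββ≈q₀ W x))))
      walk : ∀ {y} → y ≢ β x → T.f′ y ≡ B y ⊎ T.f′ y ≡ A y
      walk {y} y≢βx with y ≟ β (β x)
      ... | yes refl = inj₂ (trans T.f′q (trans (off (λ j → x≉ββx (⊢-trans W x≈βx (proj₁ j)))) (B≡Aβ (β x))))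
      ... | no y≢ββx = subst (λ z → z ≡ B y ⊎ z ≡ A y) (sym (T.f′-fix y≢βx y≢ββx))
                         ([ inj₁ , inj₂ ∘ proj₁ ]′ (Bd.follows y))

    -- The triangle x has x and `β x` in one class and `β (β x)` in the other, so a single
    -- transposition, half a toggle, merges the two walks. Its price is the step from `β x` to
    -- `A x`, the only one that may leave the graph.
    merged-boundary : NearlyHamiltonian
    merged-boundary = record
      { f = T.f′ ; f-injective = T.f′-injective
      ; total = λ y z → linked (total⁺ y z)
      ; x = x
      ; f-x = trans (T.f′-fix (β-free x ∘ sym) (ββ-free x ∘ sym)) (off (λ j → x≉ββx (⊢-trans W (proj₁ j) (proj₂ j))))
      ; f-Bx = trans (T.f′-fix (A-free (B x) ∘ sym) (λ e → ¬jββ (subst (Joined W) e jB))) on-Bx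
      ; f-βx = trans T.f′p (trans (off ¬jββ) (sym (A≡Bββ x)))
      ; follows = walk }

  module _ {ν : ℕ} (maximum : Maximum ν) (c≡ : c [] ≡ ν * 2 + 2) where
    open TwoClasses maximum c≡
    open MaximumForests maximum 2 c≡

    -- The triangle `B x` and the edge from x to `q x 0` imply `D x`. So `B x` and F form a maximum
    -- forest, and that edge merges its two classes.
    diamond⇒nearlyHamiltonian : ∃ Diamond → NearlyHamiltonian
    diamond⇒nearlyHamiltonian (x , F , |F| , cF) =
      merged-boundary x W (proj₁ (boundary (B x ∷ F))) (proj₂ (boundary (B x ∷ F)))
        (forest-boundary (B x ∷ F) (Optimal.forest o)) jB (boundary-head (B x) F (Optimal.forest o))
        x≉q₀ (c≤1⇒total W⁺ cW⁺)
      where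
      W W⁺ : Edges
      W  = (B x ∷ F) ▹ []
      W⁺ = (x , q x 0) ∷ W
      jB : Joined W (B x)
      jB = ▹-joined {B x ∷ F} [] (here refl)
      FD⊑W⁺ : F ▹ D x ⊑ W⁺
      FD⊑W⁺ = ▹-⊑ {F} (λ h∈F → Joined-mono (⊑-∷ʳ (x , q x 0) (⊑-refl W)) (▹-joined {B x ∷ F} [] (there h∈F)))
        (D⊑ W⁺ x (⊢-head W) (Joined-mono (⊑-∷ʳ (x , q x 0) (⊑-refl W)) jB))
      cW⁺ : c W⁺ ≤ 1
      cW⁺ = ℕ.≤-trans (c-antimono FD⊑W⁺) cF
      o : Optimal (B x ∷ F)
      o = optimal (ℕ.suc-injective |F|) (ℕ.≤-trans (c-∷ W x (q x 0)) (s≤s cW⁺))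
      x≉q₀ : ¬ W ⊢ x ≈ q x 0
      x≉q₀ e = ℕ.1+n≰n (ℕ.≤-trans (Optimal.C≤c o) (ℕ.≤-trans (ℕ.≤-reflexive (sym (c-∈ W e))) cW⁺))

-- Cyclic permutations as lists

module CyclicPermutation {n : ℕ} (f : Fin n → Fin n) (f-injective : Injective f) (x : Fin n)
                         (total : ∀ y → Orbit._~_ f f-injective x y) where
  open Orbit f f-injective

  n≤period : ∀ d → 0 < d → fold x f d ≡ x → n ≤ d
  n≤period d@(suc _) _ p = injective⇒≤ {f = exponent} λ {y} {z} e →
    trans (sym (exponent-fold y)) (trans (cong (λ i → fold x f (toℕ i)) e) (exponent-fold z))
    where
    exponent : Fin n → Fin d
    exponent y = fromℕ< (m%n<n (proj₁ (total y)) d)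
    exponent-fold : ∀ y → fold x f (toℕ (exponent y)) ≡ y
    exponent-fold y = trans (cong (fold x f) (toℕ-fromℕ< (m%n<n (proj₁ (total y)) d)))
      (trans (fold-mod p (proj₁ (total y))) (proj₂ (total y)))

  fold-distinct : ∀ {i j} → i < j → j < n → fold x f i ≢ fold x f j
  fold-distinct {i} {j} i<j j<n e = let 0<d , p = collision i j x i<j e in
    ℕ.<⇒≱ (ℕ.≤-<-trans (ℕ.m∸n≤m j i) j<n) (n≤period (j ∸ i) 0<d p)

  fold-closes : fold x f n ≡ x
  fold-closes with period x
  ... | d , 0<d , d≤n , p = subst (λ k → fold x f k ≡ x) (ℕ.≤-antisym d≤n (n≤period d 0<d p)) p

  fold-reaches : ∀ y → ∃ λ i → i < n × fold x f i ≡ y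
  fold-reaches y = let i , e = ~⇒bounded (total y) in toℕ i , toℕ<n i , e

linked-∷ʳ : ∀ {a r} {A : Set a} {R : A → A → Set r} (g : ℕ → A) m {z} →
            (∀ i → i < m → R (g i) (g (suc i))) → R (g m) z → Linked R (applyUpTo g (suc m) ∷ʳ z)
linked-∷ʳ g zero    st last = last ∷ [-]
linked-∷ʳ g (suc m) st last = st 0 (s≤s z≤n) ∷ linked-∷ʳ (g ∘ suc) m (λ i i<m → st (suc i) (s≤s i<m)) last

-- The regular map of a (2,s,3)-presentation

module Presented {c ℓ} (s : ℕ) (s≥3 : 3 ≤ s) (G : Group c ℓ) (n : ℕ) (card : HasCardinality G n)
                 (a b : Group.Carrier G) (P : Has[2,_,3]Presentation G s a b) where

  module G = Group G
  open G using (Carrier; _∙_; ε; ∙-congˡ; ∙-congʳ; assoc; identityˡ; identityʳ; inverseˡ; inverseʳ) renaming (_≈_ to _≈ᴳ_; _⁻¹ to _⁻¹ᴳ)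
  open GroupProperties G using (∙-cancelˡ)
  open Inverse card using (to; from; to-cong; from-cong; strictlyInverseˡ; strictlyInverseʳ)
  open Has[2,_,3]Presentation P

  private
    V = Fin n

  from-injective : ∀ {x y} → from x ≈ᴳ from y → x ≡ y
  from-injective {x} {y} e = trans (sym (strictlyInverseˡ x)) (trans (to-cong e) (strictlyInverseˡ y))

  infixl 7 _·_
  _·_ : V → Carrier → V
  x · g = to (from x ∙ g)

  from-· : ∀ x g → from (x · g) ≈ᴳ from x ∙ g
  from-· x g = strictlyInverseʳ _

  ·-cong : ∀ x {g h} → g ≈ᴳ h → x · g ≡ x · h
  ·-cong x e = to-cong (∙-congˡ e)

  ·-· : ∀ x g h → x · g · h ≡ x · (g ∙ h)
  ·-· x g h = to-cong (G.trans (∙-congʳ (from-· x g)) (assoc (from x) g h))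

  ·-ε : ∀ x → x · ε ≡ x
  ·-ε x = trans (to-cong (identityʳ (from x))) (strictlyInverseˡ x)

  ·-free : ∀ {x g} → x · g ≡ x → g ≈ᴳ ε
  ·-free {x} {g} e = ∙-cancelˡ (from x) g ε (G.trans (G.sym (from-· x g)) (G.trans (from-cong e) (G.sym (identityʳ (from x)))))

  ·-^ : ∀ k x g → fold x (_· g) k ≡ x · (_^_ G g k)
  ·-^ zero    x g = sym (·-ε x)
  ·-^ (suc k) x g = trans (sym (fold-shift (_· g) k x)) (trans (·-^ k (x · g) g) (·-· x g _))

  A B : V → V
  A x = x · a
  B x = x · b

  B-inverse : V → V
  B-inverse x = x · b ⁻¹ᴳ

  ·-order : ∀ {g k} → HasOrder G g k → ∀ x → fold x (_· g) k ≡ x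
  ·-order {g} {k} o x = trans (·-^ k x g) (trans (·-cong x (HasOrder.power o)) (·-ε x))

  ·-order-free : ∀ {g k} → HasOrder G g k → ∀ x i → 0 < i → i < k → fold x (_· g) i ≢ x
  ·-order-free {g} o x i 0<i i<k e =
    ℕ.<⇒≱ i<k (HasOrder.minimal o i 0<i (·-free {x} (trans (sym (·-^ i x g)) e)))

  BB⁻¹ : ∀ x → B (B-inverse x) ≡ x
  BB⁻¹ x = trans (·-· x (b ⁻¹ᴳ) b) (trans (·-cong x (inverseˡ b)) (·-ε x))

  B⁻¹B : ∀ x → B-inverse (B x) ≡ x
  B⁻¹B x = trans (·-· x b (b ⁻¹ᴳ)) (trans (·-cong x (inverseʳ b)) (·-ε x))

  B-cancel : ∀ {x y} → B x ≡ B y → x ≡ y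
  B-cancel {x} {y} e = trans (sym (B⁻¹B x)) (trans (cong B-inverse e) (B⁻¹B y))

  BA³ : ∀ x → B (A (B (A (B (A x))))) ≡ x
  BA³ x = trans (ab _) (trans (cong (_· (a ∙ b)) (trans (ab _) (cong (_· (a ∙ b)) (ab x)))) (·-order order-ab x))
    where
    ab : ∀ y → B (A y) ≡ y · (a ∙ b)
    ab y = ·-· y a b

  translation : Carrier → V → V
  translation h x = to (h ∙ from x)

  translation-· : ∀ h x g → translation h (x · g) ≡ translation h x · g
  translation-· h x g = to-cong (G.trans (∙-congˡ (from-· x g)) (G.trans (G.sym (assoc h (from x) g)) (∙-congʳ (G.sym (strictlyInverseʳ _)))))

  translation-translation : ∀ {g h} → g ∙ h ≈ᴳ ε → ∀ x → translation g (translation h x) ≡ x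
  translation-translation {g} {h} e x = trans (to-cong (G.trans (∙-congˡ (strictlyInverseʳ _))
    (G.trans (G.sym (assoc g h (from x))) (G.trans (∙-congʳ e) (identityˡ (from x)))))) (strictlyInverseˡ x)

  generated-connected : ∀ {S : V → V → Set} → IsEquivalence S → (∀ x → S x (A x)) → (∀ x → S x (B x)) →
                        ∀ {g} → ⟨_⟩ G (λ y → y ≈ᴳ a ⊎ y ≈ᴳ b) g → ∀ x → S x (x · g)
  generated-connected {S} eq SA SB = go
    where
    module S = IsEquivalence eq
    go : ∀ {g} → ⟨_⟩ G (λ y → y ≈ᴳ a ⊎ y ≈ᴳ b) g → ∀ x → S x (x · g)
    go (gen (inj₁ e)) x = subst (S x) (·-cong x (G.sym e)) (SA x)
    go (gen (inj₂ e)) x = subst (S x) (·-cong x (G.sym e)) (SB x)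
    go unit           x = subst (S x) (sym (·-ε x)) S.refl
    go (mul {g} {h} p q) x = S.trans (go p x) (subst (S (x · g)) (·-· x g h) (go q (x · g)))
    go (inv {g} p)    x = S.sym (subst (S (x · g ⁻¹ᴳ))
      (trans (·-· x (g ⁻¹ᴳ) g) (trans (·-cong x (inverseˡ g)) (·-ε x))) (go p (x · g ⁻¹ᴳ)))
    go (resp e p)     x = subst (S x) (·-cong x e) (go p x)

  regularMap : RegularMap n
  regularMap = record
    { A = A ; B = B ; B⁻¹ = B-inverse
    ; A² = ·-order order-a
    ; BB⁻¹ = BB⁻¹
    ; B⁻¹B = B⁻¹B
    -- The order of ab concerns `B ∘ A`; conjugation by `B` transfers it to `A ∘ B`.
    ; β³ = λ x → B-cancel (BA³ (B x))
    ; β-free = λ x e → ·-order-free order-ab (B x) 1 (s≤s z≤n) (s≤s (s≤s z≤n))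
                        (trans (sym (·-· (B x) a b)) (cong B e))
    ; A-free = λ x → ·-order-free order-a x 1 (s≤s z≤n) (s≤s (s≤s z≤n))
    ; translate = λ x y → let h = from y ∙ from x ⁻¹ᴳ in record
        { θ = translation h ; θ⁻¹ = translation (h ⁻¹ᴳ)
        ; θθ⁻¹ = translation-translation (inverseʳ h) ; θ⁻¹θ = translation-translation (inverseˡ h)
        ; θ-A = λ z → translation-· h z a ; θ-B = λ z → translation-· h z b }
        , trans (to-cong (G.trans (assoc _ _ _) (G.trans (∙-congˡ (inverseˡ (from x))) (identityʳ (from y))))) (strictlyInverseˡ y)
    ; connected = λ {S} eq SA SB x y → subst (S x)
        (trans (to-cong (G.trans (G.sym (assoc _ _ _)) (G.trans (∙-congʳ (inverseʳ (from x))) (identityˡ (from y))))) (strictlyInverseˡ y))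
        (generated-connected eq SA SB (generate (from x ⁻¹ᴳ ∙ from y)) x)
    }

  _⟿_ : Carrier → Carrier → Set ℓ
  _⟿_ = CayAdj G a b

  adjacent : ∀ {x y} → y ≡ B x ⊎ y ≡ A x → from x ⟿ from y
  adjacent {x} (inj₁ refl) = inj₂ (inj₁ (from-· x b))
  adjacent {x} (inj₂ refl) = inj₁ (from-· x a)

  X : SimpleGraph c ℓ ℓ
  X = Cay G s≥3 P

  module _ (f : V → V) (f-injective : Injective f) (x : V) (total : ∀ y → Orbit._~_ f f-injective x y) where
    open CyclicPermutation f f-injective x total

    vertex : ℕ → Carrier
    vertex i = from (fold x f i)

    vertices-unique : ∀ k → k ≤ n → Unique G.setoid (applyUpTo vertex k)
    vertices-unique k k≤n = Unique.applyUpTo⁺₁ G.setoid vertex k λ i<j j<k e →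
      fold-distinct i<j (ℕ.<-≤-trans j<k k≤n) (from-injective e)

    vertices-cover : ∀ u → Membership._∈_ G.setoid u (applyUpTo vertex n)
    vertices-cover u = let i , i<n , e = fold-reaches (to u) in
      ∈-resp-≈ G.setoid (G.trans (from-cong e) (strictlyInverseʳ u)) (∈ˢ-applyUpTo⁺ G.setoid vertex i<n)

    cycle : ∀ m → 2 ≤ m → suc m ≤ n → (∀ i → i < m → vertex i ⟿ vertex (suc i)) → vertex m ⟿ vertex 0 →
            IsCycle X (vertex 0) (applyUpTo (vertex ∘ suc) m)
    cycle m 2≤m m<n st cl = s≤s (ℕ.≤-trans 2≤m (ℕ.≤-reflexive (sym (length-applyUpTo (vertex ∘ suc) m))))
                          , linked-∷ʳ vertex m st cl
                          , vertices-unique (suc m) m<n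

  module M = RegularMap regularMap
  module F = Forests regularMap
  open Walks regularMap

  orbits×order : ∀ {g k} (o : HasOrder G g k) (inj : Injective (_· g)) → (# Orbit.orbits (_· g) inj) * k ≡ n
  orbits×order {g} {k} o inj =
    Orbit.orbit-count (_· g) inj k (·-order o) (·-order-free o) (HasOrder.positive o)

  n≡c*s : F.c [] * s ≡ n
  n≡c*s = trans (cong (_* s) (F.c-≡ [])) (orbits×order order-b F.B-injective)

  hamiltonian⇒cycle : 3 ≤ n → Hamiltonian → HasHamiltonCycle X
  hamiltonian⇒cycle 3≤n H = vertex′ 0 , applyUpTo (vertex′ ∘ suc) m
    , cycle f f-injective x (total x) m (s≤s⁻¹ (ℕ.≤-trans 3≤n (ℕ.≤-reflexive (sym 1+m≡n)))) (ℕ.≤-reflexive 1+m≡n)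
        (λ i _ → adjacent (follows _))
        (subst (λ y → vertex′ m ⟿ from y) (trans (cong (fold x f) 1+m≡n) fold-closes) (adjacent (follows _)))
    , λ u → subst (λ k → Membership._∈_ G.setoid u (applyUpTo vertex′ k)) (sym 1+m≡n) (vertices-cover f f-injective x (total x) u)
    where
    open Hamiltonian H
    m = n ∸ 1
    1+m≡n : suc m ≡ n
    1+m≡n = ℕ.m+[n∸m]≡n (ℕ.≤-trans (s≤s z≤n) 3≤n)
    x : V
    x = fromℕ< (ℕ.≤-trans (s≤s z≤n) 3≤n)
    vertex′ = vertex f f-injective x (total x)
    open CyclicPermutation f f-injective x (total x)

  nearlyHamiltonian⇒cycle : 5 ≤ n → NearlyHamiltonian → HasCycleOfLength X (n ∸ 2) × HasHamiltonPath X
  nearlyHamiltonian⇒cycle 5≤n H =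
      ( vertex′ 0 , applyUpTo (vertex′ ∘ suc) m
      , cycle f f-injective w (total w) m 2≤m (ℕ.≤-trans (ℕ.m≤n+m (suc m) 2) (ℕ.≤-reflexive 3+m≡n))
          (λ i i<m → step i (ℕ.≤-trans i<m (ℕ.m≤n+m m 2)))
          (subst₂ _⟿_ (cong from (sym at-m)) (cong from (sym f-βx)) (adjacent (inj₂ refl)))
      , trans (cong suc (length-applyUpTo (vertex′ ∘ suc) m)) (cong (_∸ 2) 3+m≡n))
    , ( applyUpTo vertex′ n
      , (applyUpTo⁺₁ vertex′ n (λ {i} i<n → step i (s≤s⁻¹ (ℕ.≤-trans i<n (ℕ.≤-reflexive (sym 3+m≡n)))))
      , vertices-unique f f-injective w (total w) n ℕ.≤-refl)
      , vertices-cover f f-injective w (total w))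
    where
    open NearlyHamiltonian H
    m = n ∸ 3
    3+m≡n : 3 + m ≡ n
    3+m≡n = ℕ.m+[n∸m]≡n (ℕ.≤-trans (s≤s (s≤s (s≤s z≤n))) 5≤n)
    2≤m : 2 ≤ m
    2≤m = ℕ.∸-monoˡ-≤ 3 5≤n
    w : V
    -- Starting right after `β x` places x, `B x`, `β x` at the last three positions m, 1 + m, 2 +
    -- m.
    w = f (M.β x)
    vertex′ = vertex f f-injective w (total w)
    open CyclicPermutation f f-injective w (total w)
    at-2+m : fold w f (2 + m) ≡ M.β x
    at-2+m = f-injective (trans (cong (fold w f) 3+m≡n) fold-closes)
    at-1+m : fold w f (1 + m) ≡ B x
    at-1+m = f-injective (trans at-2+m (sym f-Bx))
    at-m : fold w f m ≡ x
    at-m = f-injective (trans at-1+m (sym f-x))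
    step : ∀ i → i < 2 + m → vertex′ i ⟿ vertex′ (suc i)
    step i i<2+m = adjacent (follows λ e → fold-distinct i<2+m (ℕ.≤-reflexive 3+m≡n) (trans e (sym at-2+m)))

-- Residues modulo 4 and the theorem

parity-+* : ∀ k m → parity (k * 2 + m) ≡ parity m
parity-+* zero    m = refl
parity-+* (suc k) m = parity-+* k m

2k≡2⇒odd : ∀ k → k * 2 % 4 ≡ 2 → parity k ≡ 1ℙ
2k≡2⇒odd (suc zero)    _ = refl
2k≡2⇒odd (suc (suc k)) e = 2k≡2⇒odd k e

2k≡0⇒even : ∀ k → k * 2 % 4 ≡ 0 → parity k ≡ 0ℙ
2k≡0⇒even zero          _ = refl
2k≡0⇒even (suc (suc k)) e = 2k≡0⇒even k e

odd-mod-4 : ∀ k → parity k ≡ 1ℙ → k % 4 ≡ 1 ⊎ k % 4 ≡ 3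
odd-mod-4 1 _ = inj₁ refl
odd-mod-4 3 _ = inj₂ refl
odd-mod-4 (suc (suc (suc (suc k)))) e = odd-mod-4 k e

odd*k≡2 : ∀ m k → parity m ≡ 1ℙ → m * k % 4 ≡ 2 → k % 4 ≡ 2
odd*k≡2 m k odd e with k % 4 | m%n<n k 4 | odd-mod-4 m odd | trans (sym (%-distribˡ-* m k 4)) e
... | 2 | _ | _ | _ = refl
... | 0 | _ | inj₁ r | e′ = contradiction (trans (sym e′) (cong (λ r → r * 0 % 4) r)) λ ()
... | 0 | _ | inj₂ r | e′ = contradiction (trans (sym e′) (cong (λ r → r * 0 % 4) r)) λ ()
... | 1 | _ | inj₁ r | e′ = contradiction (trans (sym e′) (cong (λ r → r * 1 % 4) r)) λ ()
... | 1 | _ | inj₂ r | e′ = contradiction (trans (sym e′) (cong (λ r → r * 1 % 4) r)) λ ()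
... | 3 | _ | inj₁ r | e′ = contradiction (trans (sym e′) (cong (λ r → r * 3 % 4) r)) λ ()
... | 3 | _ | inj₂ r | e′ = contradiction (trans (sym e′) (cong (λ r → r * 3 % 4) r)) λ ()
... | suc (suc (suc (suc _))) | s≤s (s≤s (s≤s (s≤s ()))) | _ | _

theorem1p1 : ∀ {c ℓ} (s : ℕ) (s≥3 : 3 ≤ s)
    (G : Group c ℓ) (n : ℕ) (card : HasCardinality G n)
    (a b : Group.Carrier G) (P : Has[2,_,3]Presentation G s a b) →
    (n % 4 ≡ 2 → s % 4 ≡ 2 × HasHamiltonCycle (Cay G s≥3 P)) ×
    (n % 4 ≡ 0 → HasCycleOfLength (Cay G s≥3 P) (n ∸ 2) × HasHamiltonPath (Cay G s≥3 P))
theorem1p1 s s≥3 G n card a b P = residue-2 , residue-0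
  where
  open Presented s s≥3 G n card a b P
  open Walks regularMap using (one-class⇒hamiltonian; diamond⇒nearlyHamiltonian; c-positive)

  v : Fin n
  v = Inverse.to card (Group.ε G)

  T = proj₁ F.maximum-forest
  fT = proj₁ (proj₂ F.maximum-forest)
  maximum = proj₂ (proj₂ F.maximum-forest)

  C = F.c (T F.▹ [])

  c≡ : F.c [] ≡ length T * 2 + C
  c≡ = sym (F.forest-c {[]} {T} fT)

  C≤2 : C ≤ 2
  C≤2 = F.MaximumForests.C≤2 maximum C c≡ {T} (F.MaximumForests.optimal refl ℕ.≤-refl)

  1≤C : 1 ≤ C
  1≤C = c-positive (T F.▹ []) v

  k = # Orbit.orbits A F.A-injective

  n≡k*2 : k * 2 ≡ n
  n≡k*2 = orbits×order (Has[2,_,3]Presentation.order-a P) F.A-injective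

  C-parity : parity C ≡ parity k
  C-parity = trans (sym (parity-+* (length T) C)) (trans (cong parity (sym c≡)) F.c-parity)

  s≤n : s ≤ n
  s≤n = ℕ.≤-trans (ℕ.≤-reflexive (sym (ℕ.*-identityˡ s)))
          (ℕ.≤-trans (ℕ.*-monoˡ-≤ s (c-positive [] v)) (ℕ.≤-reflexive n≡c*s))

  residue-2 : n % 4 ≡ 2 → s % 4 ≡ 2 × HasHamiltonCycle X
  -- The number `c []` of s-gons has the parity of n/2; being odd, it passes the residue of n on to
  -- s.
  residue-2 e = odd*k≡2 (F.c []) s (trans F.c-parity odd) (trans (cong (_% 4) n≡c*s) e)
        , hamiltonian⇒cycle (ℕ.≤-trans s≥3 s≤n) (one-class⇒hamiltonian T fT (C≤1 C≤2 (trans C-parity odd)))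
    where
    odd : parity k ≡ 1ℙ
    odd = 2k≡2⇒odd k (trans (cong (_% 4) n≡k*2) e)
    C≤1 : ∀ {C} → C ≤ 2 → parity C ≡ 1ℙ → C ≤ 1
    C≤1 (z≤n) _ = z≤n
    C≤1 (s≤s z≤n) _ = ℕ.≤-refl
    C≤1 (s≤s (s≤s z≤n)) ()

  residue-0 : n % 4 ≡ 0 → HasCycleOfLength X (n ∸ 2) × HasHamiltonPath X
  residue-0 e = nearlyHamiltonian⇒cycle 5≤n
    (diamond⇒nearlyHamiltonian maximum c≡2
      (F.TwoClasses.diamond maximum c≡2 (F.MaximumForests.optimal refl C≤2)))
    where
    C≡2 : ∀ {C} → C ≤ 2 → 1 ≤ C → parity C ≡ 0ℙ → C ≡ 2
    C≡2 (s≤s z≤n) _ ()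
    C≡2 (s≤s (s≤s z≤n)) _ _ = refl
    c≡2 : F.c [] ≡ length T * 2 + 2
    c≡2 = trans c≡ (cong (length T * 2 +_)
      (C≡2 C≤2 1≤C (trans C-parity (2k≡0⇒even k (trans (cong (_% 4) n≡k*2) e)))))
    2≤c : 2 ≤ F.c []
    2≤c = ℕ.≤-trans (ℕ.m≤n+m 2 (length T * 2)) (ℕ.≤-reflexive (sym c≡2))
    -- Two s-gons with at least three vertices each; the bound 5 makes n - 2 at least 3, as a cycle
    -- requires.
    5≤n : 5 ≤ n
    5≤n = ℕ.≤-trans (ℕ.n≤1+n 5) (ℕ.≤-trans (ℕ.*-mono-≤ 2≤c s≥3) (ℕ.≤-reflexive n≡c*s))
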